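{- Let $T=\{2341,1243,1234\}$ and let $F_T(x)=\sum_{n\ge0}|S_n(T)|x^n$. Then $$F_T(x)=\frac{x(4x^4+3x^3-11x^2+6x-1)C(x)+2x^4-12x^3+16x^2-7x+1}{(1-2x)^2\big(1-4x+2x^2-x(1-3x)C(x)\big)},$$ where $C(x)=\frac{1-\sqrt{1-4x}}{2x}$.
   Context: $S_n$ is the set of permutations of $[n]$ ($S_0$ contains the empty permutation). A permutation avoids a pattern $\tau$ if it has no subsequence order-isomorphic to $\tau$; $S_n(T)$ is the set of permutations in $S_n$ avoiding every pattern in $T$. $C(x)$ is the Catalan generating function. -}

module Defs where

open import Data.Bool using (Bool; true; false; _∧_; not)
open import Data.Nat as ℕ using (ℕ; zero; suc; _∸_; _<ᵇ_; _≡ᵇ_)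
open import Data.Nat.Combinatorics using (_C_)
open import Data.Nat.DivMod using (_/_)
open import Data.Integer as ℤ using (ℤ; +_; -[1+_])
open import Data.List using (List; []; _∷_; _++_; map; concatMap; length; filter; upTo; foldr; zipWith)
open import Data.Bool.ListAction using (all; any; and)
open import Relation.Nullary.Decidable using (Dec; yes; no)
open import Data.Bool.Properties using (T?)

words : ℕ → ℕ → List (List ℕ)
words n zero    = [] ∷ []
words n (suc k) = concatMap (λ a → map (a ∷_) (words n k)) (upTo n)

elem : ℕ → List ℕ → Bool
elem a []       = false
elem a (b ∷ bs) = (a ≡ᵇ b) Data.Bool.∨ elem a bs
  where import Data.Bool

distinct : List ℕ → Bool
distinct []       = true
distinct (a ∷ as) = not (elem a as) ∧ distinct as

perms : ℕ → List (List ℕ)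
perms n = filter (λ w → T? (distinct w)) (words n n)

subseqs : List ℕ → List (List ℕ)
subseqs []       = [] ∷ []
subseqs (a ∷ as) = map (a ∷_) (subseqs as) ++ subseqs as

_==_ : Bool → Bool → Bool
true  == b = b
false == b = not b

orderIso : List ℕ → List ℕ → Bool
orderIso []       []       = true
orderIso (x ∷ xs) (y ∷ ys) =
  and (zipWith (λ x' y' → ((x <ᵇ x') == (y <ᵇ y')) ∧ ((x' <ᵇ x) == (y' <ᵇ y))) xs ys)
  ∧ orderIso xs ys
orderIso _        _        = false

contains : List ℕ → List ℕ → Bool
contains σ τ = any (λ s → orderIso s τ) (subseqs σ)

avoidsAll : List (List ℕ) → List ℕ → Bool
avoidsAll T σ = all (λ τ → not (contains σ τ)) T

countAvoiders : List (List ℕ) → ℕ → ℕ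
countAvoiders T n = length (filter (λ σ → T? (avoidsAll T σ)) (perms n))

Tpat : List (List ℕ)
Tpat = (2 ∷ 3 ∷ 4 ∷ 1 ∷ []) ∷ (1 ∷ 2 ∷ 4 ∷ 3 ∷ []) ∷ (1 ∷ 2 ∷ 3 ∷ 4 ∷ []) ∷ []

Series : Set
Series = ℕ → ℤ

_⊕_ : Series → Series → Series
(f ⊕ g) n = f n ℤ.+ g n

_⊖_ : Series → Series → Series
(f ⊖ g) n = f n ℤ.- g n

_⊗_ : Series → Series → Series
(f ⊗ g) n = foldr ℤ._+_ (+ 0) (map (λ i → f i ℤ.* g (n ∸ i)) (upTo (suc n)))

poly : List ℤ → Series
poly []       n       = + 0
poly (a ∷ as) zero    = a
poly (a ∷ as) (suc n) = poly as n

catalan : ℕ → ℕ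
catalan n = ((2 ℕ.* n) C n) / suc n

Cser : Series
Cser n = + catalan n

FT : Series
FT n = + countAvoiders Tpat n

neg : ℕ → ℤ
neg zero    = + 0
neg (suc k) = -[1+ k ]

numer : Series
numer = (poly (+ 0 ∷ neg 1 ∷ + 6 ∷ neg 11 ∷ + 3 ∷ + 4 ∷ []) ⊗ Cser)
        ⊕ poly (+ 1 ∷ neg 7 ∷ + 16 ∷ neg 12 ∷ + 2 ∷ [])

-- denominator  (1-2x)² (1 - 4x + 2x² - x(1-3x)C(x))
denom : Series
denom = poly (+ 1 ∷ neg 4 ∷ + 4 ∷ [])
        ⊗ (poly (+ 1 ∷ neg 4 ∷ + 2 ∷ []) ⊖ (poly (+ 0 ∷ + 1 ∷ neg 3 ∷ []) ⊗ Cser))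

{-# OPTIONS --safe #-}
module Submission where

-- A letter that is not a left-to-right minimum has at most one larger letter to its right (no 1234, no
-- 1243). So, reading a permutation from the left, each letter is a left-to-right minimum or the largest
-- or second largest unused letter. As long as no second largest letter is read, 2341 cannot arise. When a
-- second largest letter c is read and the largest letter m is thereby skipped, m must wait until all
-- unused letters exceed every letter b < c read before c. If lower gaps between the letters read are
-- occupied, then m comes last and the rest avoids 123, which gives ballot numbers; if all unused letters
-- above the minimum lie in the gap of c, there are additional completions. With C = 1 + x C² the linear
-- recurrences for the numbers of completions yield
--   F = 1 + x / (1 - 2xC) + (xC)⁴ / (1 - 2x)²,
-- and the denominator of the theorem is (1 - 2x)² (1 - 2xC) / C³.

open import Defs
open import Data.Nat using (ℕ)
open import Relation.Binary.PropositionalEquality using (_≡_)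
open import Relation.Binary.PropositionalEquality as ≡ using (refl; cong; cong₂; module ≡-Reasoning)
open import Algebra.Solver.Ring.AlmostCommutativeRing
  using (AlmostCommutativeRing; IsAlmostCommutativeRing; _-Raw-AlmostCommutative⟶_)
import Algebra.Solver.Ring as RingSolver
open import Data.Bool using (Bool; true; false; T; not; _∧_; if_then_else_)
open import Data.Bool.ListAction using (all)
open import Data.Bool.Properties using (T?; T-∧; T-≡; ∧-zeroʳ)
open import Data.Empty using (⊥; ⊥-elim)
import Data.Integer as ℤ
import Data.Integer.Properties as ℤ
open import Data.Integer.Solver using () renaming (module +-*-Solver to ℤ-Solver)
open import Data.List
  using (List; []; _∷_; _++_; _ʳ++_; map; concatMap; foldr; length; filter; applyUpTo; upTo; downFrom)
open import Data.List.Membership.Propositional using (_∈_; find; lose)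
open import Data.List.Membership.Propositional.Properties
  using (∈-map⁺; ∈-map⁻; ∈-++⁺ˡ; ∈-++⁺ʳ; ∈-++⁻; ∈-∃++)
open import Data.List.Properties
  using (filter-all; filter-none; filter-accept; filter-reject; length-++; length-++-sucʳ; length-downFrom; map-++; map-upTo;
         reverse-upTo; ++-assoc; ++-identityʳ)
open import Data.List.Relation.Binary.Permutation.Propositional
  using (_↭_; ↭-refl; ↭-sym; ↭-trans; ↭-reflexive; prep)
open import Data.List.Relation.Binary.Permutation.Propositional.Properties
  using (map⁺; ↭-length; shift; ↭-reverse; filter-↭; All-resp-↭)
open import Data.List.Relation.Binary.Sublist.Propositional
  using (_⊆_; []; _∷ʳ_; _∷_; ⊆-refl; ⊆-reflexive; ⊆-trans; minimum; from∈; to∈; lookup)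
open import Data.List.Relation.Binary.Sublist.Propositional.Properties
  using (++⁺; filter⁺; filter-⊆; length-mono-≤; All-resp-⊆)
open import Data.List.Relation.Unary.All as All using (All; []; _∷_; all?)
import Data.List.Relation.Unary.All.Properties as All
open import Data.List.Relation.Unary.AllPairs as AllPairs using (AllPairs; []; _∷_; allPairs?)
open import Data.List.Relation.Unary.AllPairs.Properties using (applyDownFrom⁺₁)
open import Data.List.Relation.Unary.Any using (here; there)
open import Data.List.Relation.Unary.Any.Properties using (any⁺; any⁻)
open import Data.List.Relation.Unary.Unique.Propositional using (Unique)
import Data.List.Relation.Unary.Unique.Propositional.Properties as Unique
open import Data.Maybe using (Maybe; just; nothing)
open import Data.Nat as ℕ using (zero; suc; z≤n; s≤s)
open import Data.Nat.Combinatorics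
  using (_C_; nCk≡nC[n∸k]; nCk+nC[k+1]≡[n+1]C[k+1]; k>n⇒nCk≡0; nC1≡n; nCn≡1)
open import Data.Nat.DivMod using (_/_; m*n/n≡m)
open import Data.Nat.ListAction using (sum)
open import Data.Nat.ListAction.Properties using (sum-++; sum-↭)
import Data.Nat.Properties as ℕ
open import Data.Nat.Solver using () renaming (module +-*-Solver to ℕ-Solver)
open import Data.Product using (_×_; _,_; proj₁; proj₂; ∃-syntax)
open import Data.Sum using (_⊎_; inj₁; inj₂; map₂)
open import Data.Unit using (⊤; tt)
open import Function using (_∘_; id; mk⇔; Equivalence)
open import Relation.Binary using (IsEquivalence; Setoid)
open import Relation.Binary.Definitions using (tri<; tri≈; tri>)
open import Relation.Nullary using (¬_; Dec; yes; no; does; ¬?; _×-dec_; _→-dec_; contradiction)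
open import Relation.Nullary.Decidable using (dec-true; dec-false; does-⇔)

-- The state reached by reading has many gaps, yet few numbers suffice, because the count splits
-- additively. The surplus has rational series, while the other part brings in powers of C. The
-- number of letters above the minimum acts as a catalytic parameter. In place of the kernel method,
-- a closed form is given for every value of it, and its difference from the true series solves a
-- homogeneous system that forces all coefficients to vanish. The closed forms are cleared of
-- denominators, and the identities among them hold only modulo the recurrences and the quadratic
-- equation of C; each is certified by explicit cofactors. The Catalan numbers of the statement are
-- binomial quotients, so the reflection principle has to link them with the ballot recurrence.

-- The last argument s counts the unused letters below all letters read, the other arguments those above
-- the least letter read. If a largest letter has been skipped, there are ballot a s completions when it
-- has to come last, and surplus a s further ones when the a letters lie in one gap of the letters read.
ballot : ℕ → ℕ → ℕ
ballot a       zero    = 1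
ballot zero    (suc s) = ballot 1 s
ballot (suc a) (suc s) = ballot a (suc s) ℕ.+ ballot (suc (suc a)) s

surplus : ℕ → ℕ → ℕ
surplus zero    s       = 0
surplus (suc h) zero    = surplus h zero ℕ.+ 2 ℕ.^ h
surplus (suc h) (suc s) = surplus (suc h) s ℕ.+ surplus h (suc s)

-- If no letter has been skipped, b letters lie in the lowest nonempty gap and a in higher ones, there are
-- freePart (a + b) s + gapPart a b s completions; gapPart counts the surplus due to letters skipped
-- before a lower gap opens. The value at a = 1, b = 0 is junk.
gapPart : ℕ → ℕ → ℕ → ℕ
gapPart zero          zero          s       = 0
gapPart zero          (suc zero)    s       = 0
gapPart zero          (suc (suc b)) zero    = gapPart 0 (suc b) 0 ℕ.+ surplus b 0
gapPart zero          (suc (suc b)) (suc s) =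
  gapPart 0 (suc (suc b)) s ℕ.+ (gapPart 0 (suc b) (suc s) ℕ.+ surplus b (suc s))
gapPart (suc zero)    zero          s       = 0
gapPart (suc zero)    (suc b)       zero    = gapPart 0 (suc b) 0 ℕ.+ surplus b 0
gapPart (suc zero)    (suc b)       (suc s) =
  gapPart 1 (suc b) s ℕ.+ (gapPart 0 (suc b) (suc s) ℕ.+ surplus b (suc s))
gapPart (suc (suc a)) b             zero    = gapPart (suc a) b zero
gapPart (suc (suc a)) b             (suc s) = gapPart (suc (suc a)) b s ℕ.+ gapPart (suc a) b (suc s)

-- The arguments of `g` add up to `s - 1`: reading one of `s` low letters lifts the larger low
-- letters above the minimum and leaves the smaller ones low.
antidiagonal : (ℕ → ℕ → ℕ) → ℕ → ℕ
antidiagonal g zero    = 0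
antidiagonal g (suc s) = g 0 s ℕ.+ antidiagonal (g ∘ suc) s

-- A new lowest gap arises only if at least one low letter larger than the one read remains, hence
-- the shift by `suc`. All `a` earlier letters then lie in higher gaps.
newGapPart : ℕ → ℕ → ℕ
newGapPart a zero    = 0
newGapPart a (suc s) = antidiagonal (gapPart a ∘ suc) s

-- The clauses differ in which of the largest and second largest letters lie above the minimum.
-- Skipping needs both, so the `ballot` term starts at two letters and is taken with these two
-- removed.
freePart : ℕ → ℕ → ℕ
freePartSum : ℕ → ℕ → ℕ
freePart zero          zero    = 1
freePart zero          (suc s) = freePartSum 0 (suc s) ℕ.+ newGapPart 0 (suc s)
freePart (suc zero)    s = freePartSum 1 s ℕ.+ (freePart 0 s ℕ.+ newGapPart 1 s)
freePart (suc (suc a)) s =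
  freePartSum (suc (suc a)) s ℕ.+ (freePart (suc a) s ℕ.+ (ballot a s ℕ.+ newGapPart (suc (suc a)) s))
freePartSum a zero    = 0
freePartSum a (suc s) = freePart a s ℕ.+ freePartSum (suc a) s

-- Pattern avoidance as a condition on each letter read

module Counting where

  open import Data.Nat using (_+_; _*_; _^_; _≤_; _<_; _>_; _≡ᵇ_; _<ᵇ_; _≟_; _<?_; _≤?_)
  open import Relation.Binary.PropositionalEquality using (sym; trans; subst)

  -- P lists the letters before r, the latest first, and w the letters after it. An occurrence of 1234
  -- or 1243 is charged to the letter playing 2, one of 2341 to the letter playing 4.
  Step : List ℕ → ℕ → List ℕ → Set
  Step P r w =
    All (λ x → x < r → length (filter (r <?_) w) ≤ 1) P
    × AllPairs (λ c b → b < c → c < r → All (b <_) w) P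

  step? : ∀ P r w → Dec (Step P r w)
  step? P r w =
    all? (λ x → (x <? r) →-dec (length (filter (r <?_) w) ≤? 1)) P
    ×-dec allPairs? (λ c b → (b <? c) →-dec ((c <? r) →-dec all? (b <?_) w)) P

  Admissible : List ℕ → List ℕ → Set
  Admissible P []      = ⊤
  Admissible P (r ∷ w) = Step P r w × Admissible (r ∷ P) w

  admissible? : ∀ P w → Dec (Admissible P w)
  admissible? P []      = yes tt
  admissible? P (r ∷ w) = step? P r w ×-dec admissible? (r ∷ P) w

  module _ {A : Set} {R : A → A → Set} where

    pair-lookup : ∀ {xs c b} → AllPairs R xs → c ∷ b ∷ [] ⊆ xs → R c b
    pair-lookup (_ ∷ ps) (_ ∷ʳ s)   = pair-lookup ps s
    pair-lookup (p ∷ _)  (refl ∷ s) = All.lookup p (to∈ s)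

    pair-tabulate : ∀ {xs} → (∀ {c b} → c ∷ b ∷ [] ⊆ xs → R c b) → AllPairs R xs
    pair-tabulate {[]}     f = []
    pair-tabulate {x ∷ xs} f = All.tabulate (λ i → f (refl ∷ from∈ i)) ∷ pair-tabulate (λ s → f (x ∷ʳ s))

  ⊆-ʳ++ : ∀ {s w : List ℕ} P → s ⊆ w → s ⊆ P ʳ++ w
  ⊆-ʳ++ []      q = q
  ⊆-ʳ++ (p ∷ P) q = ⊆-ʳ++ P (p ∷ʳ q)

  ∈-ʳ++ : ∀ {x} {s w : List ℕ} {P} → x ∈ P → s ⊆ w → x ∷ s ⊆ P ʳ++ w
  ∈-ʳ++ {P = p ∷ P} (here refl) q = ⊆-ʳ++ P (refl ∷ q)
  ∈-ʳ++ {P = p ∷ P} (there i)   q = ∈-ʳ++ i (p ∷ʳ q)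

  pair-ʳ++ : ∀ {b c} {s w : List ℕ} {P} → c ∷ b ∷ [] ⊆ P → s ⊆ w → b ∷ c ∷ s ⊆ P ʳ++ w
  pair-ʳ++ (p ∷ʳ i)   q = pair-ʳ++ i (p ∷ʳ q)
  pair-ʳ++ (refl ∷ i) q = ∈-ʳ++ (to∈ i) (refl ∷ q)

  -- Leaving `z` and `t` uncompared merges 1234 with 1243, and `¬ b < a` is the negation of what
  -- `Step` demands. The equalities z = t and a = b that are thereby also forbidden cannot occur
  -- among distinct letters.
  Avoids12-33 Avoids2341 : List ℕ → Set
  Avoids12-33 σ = ∀ {x y z t} → x ∷ y ∷ z ∷ t ∷ [] ⊆ σ → x < y → y < z → y < t → ⊥
  Avoids2341  σ = ∀ {b c d a} → b ∷ c ∷ d ∷ a ∷ [] ⊆ σ → b < c → c < d → ¬ b < a → ⊥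

  admissible⇒12-33 : ∀ {P w} → Admissible P w → Avoids12-33 w
  admissible⇒12-33 (_ , ad) (_ ∷ʳ s)   x<y y<z y<t = admissible⇒12-33 ad s x<y y<z y<t
  admissible⇒12-33 (_ , ad) (refl ∷ s) x<y y<z y<t = top3 (here refl) ad s x<y y<z y<t
    where
    top3 : ∀ {P w x y z t} → x ∈ P → Admissible P w → y ∷ z ∷ t ∷ [] ⊆ w → x < y → y < z → y < t → ⊥
    top3 i (_ , ad)        (_ ∷ʳ s)   x<y y<z y<t = top3 (there i) ad s x<y y<z y<t
    top3 {y = y} i ((st , _) , _) (refl ∷ s) x<y y<z y<t = contradiction
      (ℕ.≤-trans
        (subst (λ l → 2 ≤ length l) (sym (filter-all (y <?_) (y<z ∷ y<t ∷ []))) ℕ.≤-refl)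
        (ℕ.≤-trans (length-mono-≤ (filter⁺ (y <?_) (y <?_) (λ { refl p → p }) s)) (All.lookup st i x<y)))
      λ { (s≤s ()) }

  admissible⇒2341 : ∀ {P w} → Admissible P w → Avoids2341 w
  admissible⇒2341 (_ , ad) (_ ∷ʳ s)   b<c c<d b≮a = admissible⇒2341 ad s b<c c<d b≮a
  admissible⇒2341 (_ , ad) (refl ∷ s) b<c c<d b≮a = top3 (here refl) ad s b<c c<d b≮a
    where
    top2 : ∀ {P w b c d a} → c ∷ b ∷ [] ⊆ P → Admissible P w → d ∷ a ∷ [] ⊆ w → b < c → c < d → ¬ b < a → ⊥
    top2 i (_ , ad)        (_ ∷ʳ s)   b<c c<d b≮a = top2 (_ ∷ʳ i) ad s b<c c<d b≮a
    top2 i ((_ , st) , _)  (refl ∷ s) b<c c<d b≮a = b≮a (All.lookup (pair-lookup st i b<c c<d) (to∈ s))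
    top3 : ∀ {P w b c d a} → b ∈ P → Admissible P w → c ∷ d ∷ a ∷ [] ⊆ w → b < c → c < d → ¬ b < a → ⊥
    top3 i (_ , ad) (_ ∷ʳ s)   b<c c<d b≮a = top3 (there i) ad s b<c c<d b≮a
    top3 i (_ , ad) (refl ∷ s) b<c c<d b≮a = top2 (refl ∷ from∈ i) ad s b<c c<d b≮a

  two-of : ∀ {l : List ℕ} → ¬ length l ≤ 1 → ∃[ z ] ∃[ t ] z ∷ t ∷ [] ⊆ l
  two-of {[]}        p = contradiction z≤n p
  two-of {_ ∷ []}    p = contradiction ℕ.≤-refl p
  two-of {z ∷ t ∷ l} p = z , t , refl ∷ refl ∷ minimum l

  avoids⇒admissible : ∀ P w → Avoids12-33 (P ʳ++ w) → Avoids2341 (P ʳ++ w) → Admissible P w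
  avoids⇒admissible P []      h₁ h₂ = tt
  avoids⇒admissible P (r ∷ w) h₁ h₂ = (All.tabulate few , pair-tabulate above) , avoids⇒admissible (r ∷ P) w h₁ h₂
    where
    few : ∀ {x} → x ∈ P → x < r → length (filter (r <?_) w) ≤ 1
    few i x<r with length (filter (r <?_) w) ≤? 1
    ... | yes p = p
    ... | no ¬p with z , t , s ← two-of ¬p
      with r<z ∷ r<t ∷ [] ← All-resp-⊆ s (All.all-filter (r <?_) w) =
      ⊥-elim (h₁ (∈-ʳ++ i (refl ∷ ⊆-trans s (filter-⊆ (r <?_) w))) x<r r<z r<t)
    above : ∀ {c b} → c ∷ b ∷ [] ⊆ P → b < c → c < r → All (b <_) w
    above {b = b} i b<c c<r = All.tabulate λ {a} j → low a j
      where
      low : ∀ a → a ∈ w → b < a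
      low a j with b <? a
      ... | yes p = p
      ... | no ¬p = ⊥-elim (h₂ (pair-ʳ++ i (refl ∷ from∈ j)) b<c c<r ¬p)

  ∈-subseqs⁻ : ∀ σ {s} → s ∈ subseqs σ → s ⊆ σ
  ∈-subseqs⁻ []      (here refl) = []
  ∈-subseqs⁻ (a ∷ σ) i with ∈-++⁻ (map (a ∷_) (subseqs σ)) i
  ... | inj₂ j = a ∷ʳ ∈-subseqs⁻ σ j
  ... | inj₁ j with _ , k , refl ← ∈-map⁻ (a ∷_) j = refl ∷ ∈-subseqs⁻ σ k

  ∈-subseqs⁺ : ∀ {σ s} → s ⊆ σ → s ∈ subseqs σ
  ∈-subseqs⁺ []               = here refl
  ∈-subseqs⁺ {a ∷ σ} (_ ∷ʳ s)   = ∈-++⁺ʳ (map (a ∷_) (subseqs σ)) (∈-subseqs⁺ s)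
  ∈-subseqs⁺ {a ∷ σ} (refl ∷ s) = ∈-++⁺ˡ (∈-map⁺ (a ∷_) (∈-subseqs⁺ s))

  contains⁺ : ∀ {σ s} τ → s ⊆ σ → T (orderIso s τ) → T (contains σ τ)
  contains⁺ τ s p = any⁺ (λ s → orderIso s τ) (lose (∈-subseqs⁺ s) p)

  contains⁻ : ∀ σ τ → T (contains σ τ) → ∃[ s ] s ⊆ σ × T (orderIso s τ)
  contains⁻ σ τ p with s , i , q ← find (any⁻ (λ s → orderIso s τ) (subseqs σ) p) = s , ∈-subseqs⁻ σ i , q

  ∧⁻ : ∀ {a b} → T (a ∧ b) → T a × T b
  ∧⁻ = Equivalence.to T-∧

  ∧⁺ : ∀ {a b} → T a → T b → T (a ∧ b)
  ∧⁺ p q = Equivalence.from T-∧ (p , q)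

  ==⁻ : ∀ {a b} → T (a == b) → a ≡ b
  ==⁻ {true}  {true}  _ = refl
  ==⁻ {false} {false} _ = refl

  ==⁺ : ∀ {a b} → a ≡ b → T (a == b)
  ==⁺ {true}  refl = tt
  ==⁺ {false} refl = tt

  orderIso-length : ∀ s τ → T (orderIso s τ) → length s ≡ length τ
  orderIso-length []      []      p = refl
  orderIso-length (x ∷ s) (y ∷ τ) p = cong suc (orderIso-length s τ (proj₂ (∧⁻ p)))

  agree : ℕ → ℕ → ℕ → ℕ → Bool
  agree x y p q = ((x <ᵇ y) == (p <ᵇ q)) ∧ ((y <ᵇ x) == (q <ᵇ p))

  -- The record keeps the four numbers inferable; the bare `T (agree x y p q)` would unfold.
  record Agree (x y p q : ℕ) : Set where
    constructor agrees
    field holds : T (agree x y p q)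

  forward : ∀ {x y p q} → Agree x y p q → (x <ᵇ y) ≡ (p <ᵇ q)
  forward {x} {y} {p} {q} (agrees h) = ==⁻ (proj₁ (∧⁻ {(x <ᵇ y) == (p <ᵇ q)} h))

  orderIso₄⁻ : ∀ x y z t p q r u → T (orderIso (x ∷ y ∷ z ∷ t ∷ []) (p ∷ q ∷ r ∷ u ∷ [])) →
    Agree x y p q × Agree y z q r × Agree y t q u × Agree x t p u
  orderIso₄⁻ x y z t p q r u h
    with h₁ , h₂ ← ∧⁻ {agree x y p q ∧ (agree x z p r ∧ (agree x t p u ∧ true))} h
    with xy , h₃ ← ∧⁻ {agree x y p q} h₁ | h₄ , _ ← ∧⁻ {agree y z q r ∧ (agree y t q u ∧ true)} h₂
    with _ , h₅ ← ∧⁻ {agree x z p r} h₃ | yz , h₆ ← ∧⁻ {agree y z q r} h₄ =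
    agrees xy , agrees yz , agrees (proj₁ (∧⁻ {agree y t q u} h₆)) , agrees (proj₁ (∧⁻ {agree x t p u} h₅))

  orderIso₄ : ∀ {x y z t p q r u} → Agree x y p q → Agree x z p r → Agree x t p u →
    Agree y z q r → Agree y t q u → Agree z t r u →
    T (orderIso (x ∷ y ∷ z ∷ t ∷ []) (p ∷ q ∷ r ∷ u ∷ []))
  orderIso₄ (agrees xy) (agrees xz) (agrees xt) (agrees yz) (agrees yt) (agrees zt) =
    ∧⁺ (∧⁺ xy (∧⁺ xz (∧⁺ xt tt))) (∧⁺ (∧⁺ yz (∧⁺ yt tt)) (∧⁺ (∧⁺ zt tt) tt))

  contains₄⁻ : ∀ σ p q r u → T (contains σ (p ∷ q ∷ r ∷ u ∷ [])) → ∃[ x ] ∃[ y ] ∃[ z ] ∃[ t ]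
    x ∷ y ∷ z ∷ t ∷ [] ⊆ σ × T (orderIso (x ∷ y ∷ z ∷ t ∷ []) (p ∷ q ∷ r ∷ u ∷ []))
  contains₄⁻ σ p q r u c with s , i , o ← contains⁻ σ (p ∷ q ∷ r ∷ u ∷ []) c = four s i o (orderIso-length s _ o)
    where
    four : ∀ s → s ⊆ σ → T (orderIso s (p ∷ q ∷ r ∷ u ∷ [])) → length s ≡ 4 → _
    four (x ∷ y ∷ z ∷ t ∷ []) i o refl = x , y , z , t , i , o

  <ᵇ-true : ∀ {x y} → x < y → (x <ᵇ y) ≡ true
  <ᵇ-true p = Equivalence.to T-≡ (ℕ.<⇒<ᵇ p)

  <ᵇ-false : ∀ {x y} → ¬ x < y → (x <ᵇ y) ≡ false
  <ᵇ-false {x} {y} p with x <ᵇ y in eq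
  ... | false = refl
  ... | true  = contradiction (ℕ.<ᵇ⇒< x y (Equivalence.from T-≡ eq)) p

  <ᵇ-true⁻ : ∀ {x y} → (x <ᵇ y) ≡ true → x < y
  <ᵇ-true⁻ {x} {y} p = ℕ.<ᵇ⇒< x y (Equivalence.from T-≡ p)

  <ᵇ-false⁻ : ∀ {x y} → (x <ᵇ y) ≡ false → ¬ x < y
  <ᵇ-false⁻ p q with trans (sym p) (<ᵇ-true q)
  ... | ()

  agree-< : ∀ {x y p q} → x < y → p < q → Agree x y p q
  agree-< x<y p<q = agrees (∧⁺ (==⁺ (trans (<ᵇ-true x<y) (sym (<ᵇ-true p<q))))
    (==⁺ (trans (<ᵇ-false (ℕ.<⇒≯ x<y)) (sym (<ᵇ-false (ℕ.<⇒≯ p<q))))))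

  agree-> : ∀ {x y p q} → y < x → q < p → Agree x y p q
  agree-> y<x q<p = agrees (∧⁺ (==⁺ (trans (<ᵇ-false (ℕ.<⇒≯ y<x)) (sym (<ᵇ-false (ℕ.<⇒≯ q<p)))))
    (==⁺ (trans (<ᵇ-true y<x) (sym (<ᵇ-true q<p)))))

  literal< : ∀ {m n} {p : T (m <ᵇ n)} → m < n
  literal< {m} {n} {p} = ℕ.<ᵇ⇒< m n p

  avoids⇒T : ∀ {σ} → Avoids12-33 σ → Avoids2341 σ → T (avoidsAll Tpat σ)
  avoids⇒T {σ} h₁ h₂ = ∧⁺ (T-not no2341) (∧⁺ (T-not no1243) (∧⁺ (T-not no1234) tt))
    where
    T-not : ∀ {b} → ¬ T b → T (not b)
    T-not {true}  p = p tt
    T-not {false} p = tt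
    no2341 : ¬ T (contains σ (2 ∷ 3 ∷ 4 ∷ 1 ∷ []))
    no2341 k with b , c , d , a , i , o ← contains₄⁻ σ 2 3 4 1 k
      with bc , cd , _ , ba ← orderIso₄⁻ b c d a 2 3 4 1 o =
      h₂ i (<ᵇ-true⁻ (forward bc)) (<ᵇ-true⁻ (forward cd)) (<ᵇ-false⁻ (forward ba))
    no12-33 : ∀ p q r u → p < q → q < r → q < u → ¬ T (contains σ (p ∷ q ∷ r ∷ u ∷ []))
    no12-33 p q r u p<q q<r q<u k with x , y , z , t , i , o ← contains₄⁻ σ p q r u k
      with xy , yz , yt , _ ← orderIso₄⁻ x y z t p q r u o =
      h₁ i (<ᵇ-true⁻ (trans (forward xy) (<ᵇ-true p<q))) (<ᵇ-true⁻ (trans (forward yz) (<ᵇ-true q<r))) (<ᵇ-true⁻ (trans (forward yt) (<ᵇ-true q<u)))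
    no1243 : ¬ T (contains σ (1 ∷ 2 ∷ 4 ∷ 3 ∷ []))
    no1243 = no12-33 1 2 4 3 literal< literal< literal<
    no1234 : ¬ T (contains σ (1 ∷ 2 ∷ 3 ∷ 4 ∷ []))
    no1234 = no12-33 1 2 3 4 literal< literal< literal<

  T⇒avoids : ∀ {σ} → Unique σ → T (avoidsAll Tpat σ) → Avoids12-33 σ × Avoids2341 σ
  T⇒avoids {σ} uniq av = h₁ , h₂
    where
    split = ∧⁻ {not (contains σ (2 ∷ 3 ∷ 4 ∷ 1 ∷ []))} av
    split′ = ∧⁻ {not (contains σ (1 ∷ 2 ∷ 4 ∷ 3 ∷ []))} (proj₂ split)
    av₁ = proj₁ split
    av₂ = proj₁ split′
    av₃ = proj₁ (∧⁻ {not (contains σ (1 ∷ 2 ∷ 3 ∷ 4 ∷ []))} (proj₂ split′))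
    not⁻ : ∀ {b} → T (not b) → ¬ T b
    not⁻ {false} _ ()
    h₁ : Avoids12-33 σ
    h₁ {x} {y} {z} {t} s x<y y<z y<t with ℕ.<-cmp z t
    ... | tri< z<t _ _ = not⁻ av₃
      (contains⁺ (1 ∷ 2 ∷ 3 ∷ 4 ∷ []) s (orderIso₄ {x} {y} {z} {t} {1} {2} {3} {4}
        (agree-< x<y literal<) (agree-< (ℕ.<-trans x<y y<z) literal<) (agree-< (ℕ.<-trans x<y y<t) literal<)
        (agree-< y<z literal<) (agree-< y<t literal<) (agree-< z<t literal<)))
    ... | tri> _ _ t<z = not⁻ av₂
      (contains⁺ (1 ∷ 2 ∷ 4 ∷ 3 ∷ []) s (orderIso₄ {x} {y} {z} {t} {1} {2} {4} {3}
        (agree-< x<y literal<) (agree-< (ℕ.<-trans x<y y<z) literal<) (agree-< (ℕ.<-trans x<y y<t) literal<)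
        (agree-< y<z literal<) (agree-< y<t literal<) (agree-> t<z literal<)))
    ... | tri≈ _ z≡t _ = pair-lookup uniq (⊆-trans (x ∷ʳ (y ∷ʳ ⊆-refl)) s) z≡t
    h₂ : Avoids2341 σ
    h₂ {b} {c} {d} {a} s b<c c<d b≮a with ℕ.<-cmp a b
    ... | tri> _ _ b<a = b≮a b<a
    ... | tri≈ _ a≡b _ = pair-lookup uniq (⊆-trans (refl ∷ (c ∷ʳ (d ∷ʳ ⊆-refl))) s) (sym a≡b)
    ... | tri< a<b _ _ = not⁻ av₁
      (contains⁺ (2 ∷ 3 ∷ 4 ∷ 1 ∷ []) s (orderIso₄ {b} {c} {d} {a} {2} {3} {4} {1}
        (agree-< b<c literal<) (agree-< (ℕ.<-trans b<c c<d) literal<) (agree-> a<b literal<)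
        (agree-< c<d literal<) (agree-> (ℕ.<-trans a<b b<c) literal<)
        (agree-> (ℕ.<-trans a<b (ℕ.<-trans b<c c<d)) literal<)))

  distinct⇒Unique : ∀ w → T (distinct w) → Unique w
  distinct⇒Unique []      _ = []
  distinct⇒Unique (a ∷ w) d = All.tabulate (λ i a≡b → absent w (proj₁ (∧⁻ d)) i a≡b) ∷ distinct⇒Unique w (proj₂ (∧⁻ d))
    where
    absent : ∀ w {b} → T (not (elem a w)) → b ∈ w → a ≡ b → ⊥
    absent (c ∷ w) p (here refl) refl rewrite Equivalence.to T-≡ (ℕ.≡⇒≡ᵇ c c refl) = p
    absent (c ∷ w) p (there i)   q with a ≡ᵇ c
    ... | false = absent w p i q

  does-T : ∀ {A : Set} {b} (a? : Dec A) → (A → T b) → (T b → A) → b ≡ does a?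
  does-T {b = true}  (yes a) f g = refl
  does-T {b = false} (yes a) f g = ⊥-elim (f a)
  does-T {b = true}  (no ¬a) f g = ⊥-elim (¬a (g tt))
  does-T {b = false} (no ¬a) f g = refl

  avoidsAll≡admissible : ∀ w → T (distinct w) → avoidsAll Tpat w ≡ does (admissible? [] w)
  avoidsAll≡admissible w d = does-T (admissible? [] w)
    (λ ad → avoids⇒T (admissible⇒12-33 ad) (admissible⇒2341 ad))
    (λ av → let h₁ , h₂ = T⇒avoids (distinct⇒Unique w d) av in avoids⇒admissible [] w h₁ h₂)

  infixl 6 _∖_

  _∖_ : List ℕ → ℕ → List ℕ
  R ∖ r = filter (λ y → ¬? (r ≟ y)) R

  sumOver : List ℕ → (ℕ → ℕ) → ℕ
  sumOver R F = sum (map F R)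

  sumOver-cong : ∀ R {F G} → (∀ {r} → r ∈ R → F r ≡ G r) → sumOver R F ≡ sumOver R G
  sumOver-cong []      p = refl
  sumOver-cong (r ∷ R) p = cong₂ _+_ (p (here refl)) (sumOver-cong R (p ∘ there))

  sumOver-zero : ∀ R → sumOver R (λ _ → 0) ≡ 0
  sumOver-zero []      = refl
  sumOver-zero (_ ∷ R) = sumOver-zero R

  sumOver-filter : ∀ (p : ℕ → Bool) F R → sumOver (filter (T? ∘ p) R) F ≡ sumOver R (λ r → if p r then F r else 0)
  sumOver-filter p F []      = refl
  sumOver-filter p F (r ∷ R) with p r
  ... | true  = cong (F r +_) (sumOver-filter p F R)
  ... | false = sumOver-filter p F R

  tally : (List ℕ → Bool) → List (List ℕ) → ℕ
  tally q []       = 0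
  tally q (w ∷ ws) = (if q w then 1 else 0) + tally q ws

  tally-cong : ∀ {q q′} → (∀ w → q w ≡ q′ w) → ∀ ws → tally q ws ≡ tally q′ ws
  tally-cong p []       = refl
  tally-cong p (w ∷ ws) = cong₂ (λ b n → (if b then 1 else 0) + n) (p w) (tally-cong p ws)

  tally-false : ∀ ws → tally (λ _ → false) ws ≡ 0
  tally-false []       = refl
  tally-false (_ ∷ ws) = tally-false ws

  tally-++ : ∀ q vs ws → tally q (vs ++ ws) ≡ tally q vs + tally q ws
  tally-++ q []       ws = refl
  tally-++ q (v ∷ vs) ws = trans (cong ((if q v then 1 else 0) +_) (tally-++ q vs ws)) (sym (ℕ.+-assoc (if q v then 1 else 0) _ _))

  tally-map : ∀ q f ws → tally q (map f ws) ≡ tally (q ∘ f) ws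
  tally-map q f []       = refl
  tally-map q f (w ∷ ws) = cong ((if q (f w) then 1 else 0) +_) (tally-map q f ws)

  tally-concatMap : ∀ q f as → tally q (concatMap f as) ≡ sumOver as (λ a → tally q (f a))
  tally-concatMap q f []       = refl
  tally-concatMap q f (a ∷ as) = trans (tally-++ q (f a) _) (cong (tally q (f a) +_) (tally-concatMap q f as))

  length-filter-filter : ∀ (d q : List ℕ → Bool) ws →
    length (filter (T? ∘ q) (filter (T? ∘ d) ws)) ≡ tally (λ w → d w ∧ q w) ws
  length-filter-filter d q []       = refl
  length-filter-filter d q (w ∷ ws) with d w
  ... | false = length-filter-filter d q ws
  ... | true with q w
  ...   | false = length-filter-filter d q ws
  ...   | true  = cong suc (length-filter-filter d q ws)

  arrangements : ℕ → List ℕ → (List ℕ → Bool) → ℕ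
  arrangements zero    R q = if q [] then 1 else 0
  arrangements (suc k) R q = sumOver R (λ r → arrangements k (R ∖ r) (q ∘ (r ∷_)))

  without : (ℕ → Bool) → ℕ → ℕ → Bool
  without fresh a b = fresh b ∧ not (a ≡ᵇ b)

  filter-without : ∀ fresh a R → filter (T? ∘ without fresh a) R ≡ filter (T? ∘ fresh) R ∖ a
  filter-without fresh a []      = refl
  filter-without fresh a (b ∷ R) with fresh b
  ... | false = filter-without fresh a R
  ... | true with a ≡ᵇ b
  ...   | true  = filter-without fresh a R
  ...   | false = cong (b ∷_) (filter-without fresh a R)

  all-without : ∀ fresh a w → all (without fresh a) w ≡ all fresh w ∧ not (elem a w)
  all-without fresh a []      = refl
  all-without fresh a (b ∷ w) rewrite all-without fresh a w with fresh b | a ≡ᵇ b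
  ... | false | _     = refl
  ... | true  | true  = sym (∧-zeroʳ (all fresh w))
  ... | true  | false = refl

  sumOver-upTo : ∀ n F → sumOver (upTo n) F ≡ sumOver (downFrom n) F
  sumOver-upTo n F = sum-↭ (map⁺ F (↭-trans (↭-sym (↭-reverse (upTo n))) (↭-reflexive (reverse-upTo n))))

  -- The restriction `fresh` is what the induction needs: after a first letter `a` the rest must be
  -- distinct and miss `a`, and the latter condition is absorbed into `fresh`.
  tally-words : ∀ n k fresh q → tally (λ w → distinct w ∧ (all fresh w ∧ q w)) (words n k)
    ≡ arrangements k (filter (T? ∘ fresh) (downFrom n)) q
  tally-words n zero    fresh q = ℕ.+-identityʳ _
  tally-words n (suc k) fresh q = begin
    tally Q (concatMap (λ a → map (a ∷_) (words n k)) (upTo n))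
      ≡⟨ tally-concatMap Q _ (upTo n) ⟩
    sumOver (upTo n) (λ a → tally Q (map (a ∷_) (words n k)))
      ≡⟨ sumOver-upTo n _ ⟩
    sumOver (downFrom n) (λ a → tally Q (map (a ∷_) (words n k)))
      ≡⟨ sumOver-cong (downFrom n) (λ {a} _ → trans (tally-map Q (a ∷_) (words n k)) (first a)) ⟩
    sumOver (downFrom n) (λ a → if fresh a then arrangements k (R ∖ a) (q ∘ (a ∷_)) else 0)
      ≡⟨ sumOver-filter fresh _ (downFrom n) ⟨
    sumOver R (λ a → arrangements k (R ∖ a) (q ∘ (a ∷_))) ∎
    where
    open ≡-Reasoning
    R = filter (T? ∘ fresh) (downFrom n)
    Q : List ℕ → Bool
    Q w = distinct w ∧ (all fresh w ∧ q w)
    reorder : ∀ e d f g → (not e ∧ d) ∧ (f ∧ g) ≡ d ∧ ((f ∧ not e) ∧ g)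
    reorder true  true  true  g = refl
    reorder true  true  false g = refl
    reorder true  false f     g = refl
    reorder false true  true  g = refl
    reorder false true  false g = refl
    reorder false false f     g = refl
    first : ∀ a → tally (Q ∘ (a ∷_)) (words n k) ≡ (if fresh a then arrangements k (R ∖ a) (q ∘ (a ∷_)) else 0)
    first a with fresh a
    ... | false = trans (tally-cong (λ w → ∧-zeroʳ (not (elem a w) ∧ distinct w)) (words n k)) (tally-false (words n k))
    ... | true  = begin
      tally (λ w → (not (elem a w) ∧ distinct w) ∧ (all fresh w ∧ q (a ∷ w))) (words n k)
        ≡⟨ tally-cong (λ w → trans (reorder (elem a w) (distinct w) (all fresh w) (q (a ∷ w)))
             (cong (λ b → distinct w ∧ (b ∧ q (a ∷ w))) (sym (all-without fresh a w)))) (words n k) ⟩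
      tally (λ w → distinct w ∧ (all (without fresh a) w ∧ q (a ∷ w))) (words n k)
        ≡⟨ tally-words n k (without fresh a) (q ∘ (a ∷_)) ⟩
      arrangements k (filter (T? ∘ without fresh a) (downFrom n)) (q ∘ (a ∷_))
        ≡⟨ cong (λ R → arrangements k R (q ∘ (a ∷_))) (filter-without fresh a (downFrom n)) ⟩
      arrangements k (R ∖ a) (q ∘ (a ∷_)) ∎

  ∖-split : ∀ xs {r ys} → Unique (xs ++ r ∷ ys) → (xs ++ r ∷ ys) ∖ r ≡ xs ++ ys
  ∖-split []       {r} {ys} (u ∷ _) = trans (filter-reject (λ y → ¬? (r ≟ y)) (λ p → p refl)) (filter-all _ u)
  ∖-split (x ∷ xs) {r} (u ∷ us) = trans
    (filter-accept (λ y → ¬? (r ≟ y)) (λ r≡x → All.head (All.++⁻ʳ xs u) (sym r≡x)))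
    (cong (x ∷_) (∖-split xs us))

  ∖-↭ : ∀ {R r} → Unique R → r ∈ R → r ∷ (R ∖ r) ↭ R
  ∖-↭ u i with xs , ys , refl ← ∈-∃++ i = ↭-trans (prep _ (↭-reflexive (∖-split xs u))) (↭-sym (shift _ xs ys))

  ∖-unique : ∀ {R} r → Unique R → Unique (R ∖ r)
  ∖-unique r = Unique.filter⁺ (λ y → ¬? (r ≟ y))

  ∖-length : ∀ {R r k} → Unique R → r ∈ R → length R ≡ suc k → length (R ∖ r) ≡ k
  ∖-length u i l = ℕ.suc-injective (trans (↭-length (∖-↭ u i)) l)

  arrangements-cong : ∀ k {R q q′} → Unique R → length R ≡ k → (∀ w → w ↭ R → q w ≡ q′ w) →
    arrangements k R q ≡ arrangements k R q′
  arrangements-cong zero    {[]} u l p = cong (if_then 1 else 0) (p [] ↭-refl)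
  arrangements-cong (suc k) {R}  u l p = sumOver-cong R λ {r} i →
    arrangements-cong k (∖-unique r u) (∖-length u i l)
      λ w s → p (r ∷ w) (↭-trans (prep r s) (∖-↭ u i))

  arrangements-false : ∀ k R → arrangements k R (λ _ → false) ≡ 0
  arrangements-false zero    R = refl
  arrangements-false (suc k) R = trans (sumOver-cong R (λ {r} _ → arrangements-false k (R ∖ r))) (sumOver-zero R)

  arrangements-∧ : ∀ k R b q → arrangements k R (λ w → b ∧ q w) ≡ (if b then arrangements k R q else 0)
  arrangements-∧ k R true  q = refl
  arrangements-∧ k R false q = arrangements-false k R

  completions : ℕ → List ℕ → List ℕ → ℕ
  completions zero    P R = 1
  completions (suc k) P R =
    sumOver R (λ r → if does (step? P r (R ∖ r)) then completions k (r ∷ P) (R ∖ r) else 0)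

  Step-↭ : ∀ {P r w w′} → w ↭ w′ → Step P r w → Step P r w′
  Step-↭ {r = r} s (few , above) =
    All.map (λ f x<r → subst (_≤ 1) (↭-length (filter-↭ (r <?_) s)) (f x<r)) few
    , AllPairs.map (λ f b<c c<r → All-resp-↭ s (f b<c c<r)) above

  arrangements-admissible : ∀ k P R → Unique R → length R ≡ k →
    arrangements k R (λ w → does (admissible? P w)) ≡ completions k P R
  arrangements-admissible zero    P R u l = refl
  arrangements-admissible (suc k) P R u l = sumOver-cong R λ {r} i → begin
    arrangements k (R ∖ r) (λ w → does (step? P r w) ∧ does (admissible? (r ∷ P) w))
      ≡⟨ arrangements-cong k (∖-unique r u) (∖-length u i l)
           (λ w s → cong (_∧ does (admissible? (r ∷ P) w))
             (does-⇔ (mk⇔ (Step-↭ s) (Step-↭ (↭-sym s))) (step? P r w) (step? P r (R ∖ r)))) ⟩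
    arrangements k (R ∖ r) (λ w → does (step? P r (R ∖ r)) ∧ does (admissible? (r ∷ P) w))
      ≡⟨ arrangements-∧ k (R ∖ r) (does (step? P r (R ∖ r))) (λ w → does (admissible? (r ∷ P) w)) ⟩
    (if does (step? P r (R ∖ r)) then arrangements k (R ∖ r) (λ w → does (admissible? (r ∷ P) w)) else 0)
      ≡⟨ cong (if does (step? P r (R ∖ r)) then_else 0)
           (arrangements-admissible k (r ∷ P) (R ∖ r) (∖-unique r u) (∖-length u i l)) ⟩
    (if does (step? P r (R ∖ r)) then completions k (r ∷ P) (R ∖ r) else 0) ∎
    where open ≡-Reasoning

  countAvoiders-completions : ∀ n → countAvoiders Tpat n ≡ completions n [] (downFrom n)
  countAvoiders-completions n = begin
    countAvoiders Tpat n
      ≡⟨ length-filter-filter distinct (avoidsAll Tpat) (words n n) ⟩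
    tally (λ w → distinct w ∧ avoidsAll Tpat w) (words n n)
      ≡⟨ tally-cong test (words n n) ⟩
    tally (λ w → distinct w ∧ (all (λ _ → true) w ∧ does (admissible? [] w))) (words n n)
      ≡⟨ tally-words n n (λ _ → true) (λ w → does (admissible? [] w)) ⟩
    arrangements n (filter (T? ∘ (λ _ → true)) (downFrom n)) (λ w → does (admissible? [] w))
      ≡⟨ cong (λ R → arrangements n R (λ w → does (admissible? [] w)))
           (filter-all _ (All.tabulate {xs = downFrom n} (λ _ → _))) ⟩
    arrangements n (downFrom n) (λ w → does (admissible? [] w))
      ≡⟨ arrangements-admissible n [] (downFrom n) (Unique.downFrom⁺ n) (length-downFrom n) ⟩
    completions n [] (downFrom n) ∎
    where
    open ≡-Reasoning
    all-true : ∀ (w : List ℕ) → all (λ _ → true) w ≡ true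
    all-true []      = refl
    all-true (_ ∷ w) = all-true w
    test : ∀ w → distinct w ∧ avoidsAll Tpat w ≡ distinct w ∧ (all (λ _ → true) w ∧ does (admissible? [] w))
    test w with distinct w in d
    ... | false = refl
    ... | true rewrite all-true w = avoidsAll≡admissible w (subst T (sym d) _)

  -- Which letters may be read next

  Descending : List ℕ → Set
  Descending = AllPairs _>_

  descending-⊆ : ∀ {s R} → s ⊆ R → Descending R → Descending s
  descending-⊆ t d = pair-tabulate λ s → pair-lookup d (⊆-trans s t)

  descending-unique : ∀ {R} → Descending R → Unique R
  descending-unique = AllPairs.map λ x>y x≡y → ℕ.<⇒≢ x>y (sym x≡y)

  cross : ∀ xs {ys x y} → Descending (xs ++ ys) → x ∈ xs → y ∈ ys → y < x
  cross (x ∷ xs) (d ∷ _)  (here refl) j = All.lookup d (∈-++⁺ʳ xs j)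
  cross (_ ∷ xs) (_ ∷ ds) (there i)   j = cross xs ds i j

  branch : ℕ → List ℕ → List ℕ → ℕ → ℕ
  branch k P R r = if does (step? P r (R ∖ r)) then completions k (r ∷ P) (R ∖ r) else 0

  branch-yes : ∀ k P xs {r ys} → Descending (xs ++ r ∷ ys) → Step P r (xs ++ ys) →
    branch k P (xs ++ r ∷ ys) r ≡ completions k (r ∷ P) (xs ++ ys)
  branch-yes k P xs {r} {ys} d s rewrite ∖-split xs (descending-unique d) | dec-true (step? P r (xs ++ ys)) s = refl

  branch-no : ∀ k P xs {r ys} → Descending (xs ++ r ∷ ys) → ¬ Step P r (xs ++ ys) →
    branch k P (xs ++ r ∷ ys) r ≡ 0
  branch-no k P xs {r} {ys} d s rewrite ∖-split xs (descending-unique d) | dec-false (step? P r (xs ++ ys)) s = refl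

  step-low : ∀ {P l w} → (∀ {x} → x ∈ P → l < x) → Step P l w
  step-low low =
    All.tabulate (λ i x<l → contradiction x<l (ℕ.<⇒≯ (low i)))
    , pair-tabulate (λ s b<c c<l → contradiction c<l (ℕ.<⇒≯ (low (to∈ s))))

  none-above : ∀ {r w} → All (_< r) w → filter (r <?_) w ≡ []
  none-above d = filter-none _ (All.map ℕ.<⇒≯ d)

  branch-max : ∀ k P {m R} → Descending (m ∷ R) →
    (∀ {c b} → c ∷ b ∷ [] ⊆ P → b < c → c < m → ∀ {z} → z ∈ R → b < z) →
    branch k P (m ∷ R) m ≡ completions k (m ∷ P) R
  branch-max k P {m} {R} d@(m> ∷ _) h = branch-yes k P [] d
    ( All.tabulate (λ _ _ → subst (λ l → length l ≤ 1) (sym (none-above m>)) z≤n)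
    , pair-tabulate (λ s b<c c<m → All.tabulate (h s b<c c<m)))

  -- Read now, `m` would play 4 in the 2341 formed by `b`, `c`, `m` and the later `z`.
  branch-max-blocked : ∀ k P {m R c b z} → Descending (m ∷ R) →
    c ∷ b ∷ [] ⊆ P → b < c → c < m → z ∈ R → z < b → branch k P (m ∷ R) m ≡ 0
  branch-max-blocked k P d s b<c c<m i z<b = branch-no k P [] d
    λ st → ℕ.<⇒≯ z<b (All.lookup (pair-lookup (proj₂ st) s b<c c<m) i)

  branch-second : ∀ k P {m c R} → Descending (m ∷ c ∷ R) →
    (∀ {c′ b} → c′ ∷ b ∷ [] ⊆ P → b < c′ → c′ < c → ∀ {z} → z ∈ m ∷ R → b < z) →
    branch k P (m ∷ c ∷ R) c ≡ completions k (c ∷ P) (m ∷ R)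
  branch-second k P {m} {c} {R} d@((c<m ∷ _) ∷ c> ∷ _) h = branch-yes k P (m ∷ []) d
    ( All.tabulate (λ _ _ → subst (λ l → length l ≤ 1)
        (sym (trans (filter-accept (c <?_) c<m) (cong (m ∷_) (none-above c>)))) ℕ.≤-refl)
    , pair-tabulate (λ s b<c c<m → All.tabulate (h s b<c c<m)))

  -- With `x` already read and `m`, `c` still to come, `r` would play 2 in a 1234 or 1243.
  branch-third : ∀ k P {m c} xs {r ys x} → Descending (m ∷ c ∷ xs ++ r ∷ ys) → x ∈ P → x < r →
    branch k P (m ∷ c ∷ xs ++ r ∷ ys) r ≡ 0
  branch-third k P {m} {c} xs {r} {ys} d i x<r = branch-no k P (m ∷ c ∷ xs) d λ st → contradiction
    (subst (λ l → length l ≤ 1)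
      (trans (filter-accept (r <?_) (cross (m ∷ c ∷ xs) d (here refl) (here refl)))
        (cong (m ∷_) (filter-accept (r <?_) (cross (m ∷ c ∷ xs) d (there (here refl)) (here refl)))))
      (All.lookup (proj₁ st) i x<r))
    λ { (s≤s ()) }

  sumOver-++ : ∀ xs ys F → sumOver (xs ++ ys) F ≡ sumOver xs F + sumOver ys F
  sumOver-++ xs ys F = trans (cong sum (map-++ F xs ys)) (sum-++ (map F xs) (map F ys))

  sumOver-antidiagonal : ∀ L F g → (∀ L₁ {l L₂} → L ≡ L₁ ++ l ∷ L₂ → F l ≡ g (length L₁) (length L₂)) →
    sumOver L F ≡ antidiagonal g (length L)
  sumOver-antidiagonal []      F g h = refl
  sumOver-antidiagonal (l ∷ L) F g h =
    cong₂ _+_ (h [] refl) (sumOver-antidiagonal L F (g ∘ suc) (λ L₁ → h (l ∷ L₁) ∘ cong (l ∷_)))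

  top-sum : ∀ k P m c U L → Descending (m ∷ c ∷ U ++ L) → (∀ {u} → u ∈ U → ∃[ x ] x ∈ P × x < u) →
    let F = branch k P (m ∷ c ∷ U ++ L) in sumOver (m ∷ c ∷ U ++ L) F ≡ F m + (F c + sumOver L F)
  top-sum k P m c U L d up = cong (λ n → F m + (F c + n))
    (trans (sumOver-++ U L F) (cong (_+ sumOver L F)
      (trans (sumOver-cong U third) (sumOver-zero U))))
    where
    F = branch k P (m ∷ c ∷ U ++ L)
    third : ∀ {u} → u ∈ U → F u ≡ 0
    third {u} i with x , j , x<u ← up i with xs , ys , refl ← ∈-∃++ i =
      subst (λ R → branch k P (m ∷ c ∷ R) u ≡ 0) (sym (++-assoc xs (u ∷ ys) L))
        (branch-third k P xs (subst (λ R → Descending (m ∷ c ∷ R)) (++-assoc xs (u ∷ ys) L) d) j x<u)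

  -- After `l` the letters of `L₁` lie above the minimum and those of `L₂` below, so a summand
  -- depends on the choice of `l` only through two lengths.
  low-sum : ∀ k P U L g → Descending (U ++ L) → (∀ {l x} → l ∈ L → x ∈ P → l < x) →
    (∀ L₁ {l L₂} → L ≡ L₁ ++ l ∷ L₂ → completions k (l ∷ P) ((U ++ L₁) ++ L₂) ≡ g (length L₁) (length L₂)) →
    sumOver L (branch k P (U ++ L)) ≡ antidiagonal g (length L)
  low-sum k P U L g d low h = sumOver-antidiagonal L _ g one
    where
    one : ∀ L₁ {l L₂} → L ≡ L₁ ++ l ∷ L₂ → branch k P (U ++ L) l ≡ g (length L₁) (length L₂)
    one L₁ {l} {L₂} refl = trans
      (subst (λ R → branch k P R l ≡ completions k (l ∷ P) ((U ++ L₁) ++ L₂)) (++-assoc U L₁ (l ∷ L₂))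
        (branch-yes k P (U ++ L₁) (subst Descending (sym (++-assoc U L₁ (l ∷ L₂))) d)
          (step-low (low (∈-++⁺ʳ L₁ (here refl))))))
      (h L₁ refl)

  -- Antidiagonal sums of ballot numbers

  antidiagonal-cong : ∀ {f g} → (∀ u s → f u s ≡ g u s) → ∀ s → antidiagonal f s ≡ antidiagonal g s
  antidiagonal-cong p zero    = refl
  antidiagonal-cong p (suc s) = cong₂ _+_ (p 0 s) (antidiagonal-cong (p ∘ suc) s)

  antidiagonal-+ : ∀ f g s → antidiagonal (λ u t → f u t + g u t) s ≡ antidiagonal f s + antidiagonal g s
  antidiagonal-+ f g zero    = refl
  antidiagonal-+ f g (suc s) = trans (cong (f 0 s + g 0 s +_) (antidiagonal-+ (f ∘ suc) (g ∘ suc) s))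
    (solve 4 (λ a b c d → a :+ b :+ (c :+ d) := a :+ c :+ (b :+ d)) refl (f 0 s) (g 0 s) _ _)
    where open ℕ-Solver

  ballots : ℕ → ℕ → ℕ
  ballots a = antidiagonal (λ u → ballot (a + u))

  ballots-suc : ∀ a s → ballots a (suc s) ≡ ballot a s + ballots (suc a) s
  ballots-suc a s = cong₂ (λ b n → ballot b s + n) (ℕ.+-identityʳ a)
    (antidiagonal-cong (λ u t → cong (λ b → ballot b t) (ℕ.+-suc a u)) s)

  -- The reading process sums over all low letters at once, whereas `ballot` has a two-term
  -- recurrence; the sum telescopes to its second term.
  ballot-suc : ∀ a s → ballot (suc a) s ≡ ballot a s + ballots (suc a) s
  ballot-suc a zero    = sym (ℕ.+-identityʳ 1)
  ballot-suc a (suc s) = cong (ballot a (suc s) +_) (trans (ballot-suc (suc a) s) (sym (ballots-suc (suc a) s)))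

  ballot-0 : ∀ s → ballot 0 (suc s) ≡ ballots 0 (suc s)
  ballot-0 s = trans (ballot-suc 0 s) (sym (ballots-suc 0 s))

  -- States of the reading process, and a skipped letter that comes last

  -- P lists the letters read, the latest first, U the unused letters above its minimum and L those below;
  -- a skipped largest letter is in neither list. Here c is later than b in c ∷ b ∷ [] ⊆ P.
  record Base (P U L : List ℕ) : Set where
    field
      desc   : Descending (U ++ L)
      up     : ∀ {u} → u ∈ U → ∃[ x ] x ∈ P × x < u
      low    : ∀ {l x} → l ∈ L → x ∈ P → l < x
      closed : ∀ {c b} → c ∷ b ∷ [] ⊆ P → b < c → ∀ {r} → r ∈ U ++ L → r < c

  base-tail : ∀ {P c U L} → Base P (c ∷ U) L → Base P U L
  base-tail B = record
    { desc = AllPairs.tail desc ; up = up ∘ there ; low = low ; closed = λ s b<c → closed s b<c ∘ there }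
    where open Base B

  -- The invariant `closed` says that no letter of `U ++ L` can play 4 above an ascent already read.
  -- New ascents have the top `c`, and `c` exceeds all that remains.
  base-top : ∀ {P c U L} → Base P (c ∷ U) L → Base (c ∷ P) U L
  base-top {P} {c} {U} {L} B = record
    { desc   = AllPairs.tail desc
    ; up     = λ i → let x , j , x<u = up (there i) in x , there j , x<u
    ; low    = λ { i (here refl) → cross (c ∷ U) desc (here refl) i ; i (there j) → low i j }
    ; closed = closed′
    }
    where
    open Base B
    closed′ : ∀ {c′ b} → c′ ∷ b ∷ [] ⊆ c ∷ P → b < c′ → ∀ {r} → r ∈ U ++ L → r < c′
    closed′ (_ ∷ʳ s)   b<c i = closed s b<c (there i)
    closed′ (refl ∷ s) b<c i = All.lookup (AllPairs.head desc) i

  low-⊆ : ∀ U L₁ {l : ℕ} {L₂} → (U ++ L₁) ++ L₂ ⊆ U ++ L₁ ++ l ∷ L₂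
  low-⊆ U L₁ {l} {L₂} = ⊆-trans (⊆-reflexive (++-assoc U L₁ L₂)) (++⁺ (⊆-refl {x = U}) (++⁺ (⊆-refl {x = L₁}) (l ∷ʳ ⊆-refl)))

  base-low : ∀ {P U} L₁ {l L₂} → Base P U (L₁ ++ l ∷ L₂) → Base (l ∷ P) (U ++ L₁) L₂
  base-low {P} {U} L₁ {l} {L₂} B = record
    { desc   = descending-⊆ (low-⊆ U L₁) desc
    ; up     = up′
    ; low    = λ { i (here refl) → cross (l ∷ []) ldesc (here refl) i ; i (there j) → low (∈-++⁺ʳ L₁ (there i)) j }
    ; closed = closed′
    }
    where
    open Base B
    Ldesc : Descending (L₁ ++ l ∷ L₂)
    Ldesc = descending-⊆ (++⁺ (minimum U) ⊆-refl) desc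
    ldesc : Descending (l ∷ L₂)
    ldesc = descending-⊆ (++⁺ (minimum L₁) ⊆-refl) Ldesc
    up′ : ∀ {u} → u ∈ U ++ L₁ → ∃[ x ] x ∈ l ∷ P × x < u
    up′ i with ∈-++⁻ U i
    ... | inj₁ j = let x , k , x<u = up j in x , there k , x<u
    ... | inj₂ j = l , here refl , cross L₁ Ldesc j (here refl)
    closed′ : ∀ {c b} → c ∷ b ∷ [] ⊆ l ∷ P → b < c → ∀ {r} → r ∈ (U ++ L₁) ++ L₂ → r < c
    closed′ (_ ∷ʳ s)   b<c i = closed s b<c (lookup (low-⊆ U L₁) i)
    closed′ (refl ∷ s) b<l i = contradiction b<l (ℕ.<⇒≯ (low (∈-++⁺ʳ L₁ (here refl)) (to∈ s)))

  low-length : ∀ (U L₁ : List ℕ) l L₂ k → length (U ++ L₁ ++ l ∷ L₂) ≡ suc k → length ((U ++ L₁) ++ L₂) ≡ k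
  low-length U L₁ l L₂ k p = ℕ.suc-injective (trans (sym (length-++-sucʳ (U ++ L₁) l L₂))
    (trans (cong length (++-assoc U L₁ (l ∷ L₂))) p))

  -- The letter m has been skipped. The letters b, c and m complete 2341 with any later letter below b, and
  -- every unused letter other than m is at or above such a letter; hence m comes last.
  record Blocked (P : List ℕ) (m : ℕ) (U L : List ℕ) : Set where
    field
      base      : Base P U L
      top       : ∀ {r} → r ∈ U ++ L → r < m
      c b       : ℕ
      ascent    : c ∷ b ∷ [] ⊆ P
      b<c       : b < c
      c<m       : c < m
      low<b     : ∀ {l} → l ∈ L → l < b
      coinitial : ∀ {u} → u ∈ U → ∃[ z ] z ∈ U × z ≤ u × z < b
    open Base base public

    desc-m : Descending (m ∷ U ++ L)
    desc-m = All.tabulate top ∷ desc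

    stuck : ∀ {r} → r ∈ U ++ L → ∃[ z ] z ∈ U ++ L × z < b
    stuck i with ∈-++⁻ U i
    ... | inj₁ j = let z , k , _ , z<b = coinitial j in z , ∈-++⁺ˡ k , z<b
    ... | inj₂ j = _ , ∈-++⁺ʳ U j , low<b j

  -- Asking for a witness below each `u` lets `coinitial` survive the removal of the largest letter:
  -- `c` itself is a witness only for letters at or above it, and none of these remain.
  blocked-top : ∀ {P m c U L} → Blocked P m (c ∷ U) L → Blocked (c ∷ P) m U L
  blocked-top {P} {m} {c} {U} {L} B = record
    { base = base-top base ; top = top ∘ there
    ; ascent = c ∷ʳ ascent ; b<c = b<c ; c<m = c<m ; low<b = low<b ; coinitial = coinitial′ }
    where
    open Blocked B hiding (c)
    coinitial′ : ∀ {u} → u ∈ U → ∃[ z ] z ∈ U × z ≤ u × z < b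
    coinitial′ i with coinitial (there i)
    ... | z , there j , z≤u , z<b = z , j , z≤u , z<b
    ... | z , here refl , c≤u , _ =
      contradiction c≤u (ℕ.<⇒≱ (All.lookup (AllPairs.head desc) (∈-++⁺ˡ i)))

  blocked-low : ∀ {P m U} L₁ {l L₂} → Blocked P m U (L₁ ++ l ∷ L₂) → Blocked (l ∷ P) m (U ++ L₁) L₂
  blocked-low {P} {m} {U} L₁ {l} {L₂} B = record
    { base = base-low L₁ base ; top = top ∘ lookup (low-⊆ U L₁)
    ; ascent = l ∷ʳ ascent ; b<c = b<c ; c<m = c<m ; low<b = low<b ∘ ∈-++⁺ʳ L₁ ∘ there ; coinitial = coinitial′ }
    where
    open Blocked B
    coinitial′ : ∀ {u} → u ∈ U ++ L₁ → ∃[ z ] z ∈ U ++ L₁ × z ≤ u × z < b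
    coinitial′ i with ∈-++⁻ U i
    ... | inj₁ j = let z , k , z≤u , z<b = coinitial j in z , ∈-++⁺ˡ k , z≤u , z<b
    ... | inj₂ j = _ , i , ℕ.≤-refl , low<b (∈-++⁺ˡ j)

  -- The branch of `m` is empty until `m` is alone. Besides the low letters only the largest letter
  -- of `U` may then be read, since `m` already is one larger letter to come.
  blocked-count : ∀ k {P m U L} → length (U ++ L) ≡ k → Blocked P m U L →
    completions (suc k) P (m ∷ U ++ L) ≡ ballot (length U) (length L)
  blocked-count zero {P} {m} {[]} {[]} p B = trans (ℕ.+-identityʳ _) (branch-max 0 P ([] ∷ []) λ _ _ _ ())
  blocked-count (suc k) {P} {m} {U} {L} p B = cases U p B
    where
    max-zero : ∀ {U L r} → Blocked P m U L → r ∈ U ++ L → branch (suc k) P (m ∷ U ++ L) m ≡ 0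
    max-zero B i = let z , j , z<b = stuck i in branch-max-blocked (suc k) P desc-m ascent b<c c<m j z<b
      where open Blocked B
    lows : ∀ U {L} → length (U ++ L) ≡ suc k → Blocked P m U L →
      sumOver L (branch (suc k) P (m ∷ U ++ L)) ≡ ballots (length U) (length L)
    lows U {L} p B = low-sum (suc k) P (m ∷ U) L _ (Blocked.desc-m B) (Blocked.low B) λ { L₁ {l} {L₂} refl →
      trans (blocked-count k (low-length U L₁ l L₂ k p) (blocked-low L₁ B))
        (cong (λ n → ballot n (length L₂)) (length-++ U)) }
    cases : ∀ U {L} → length (U ++ L) ≡ suc k → Blocked P m U L →
      completions (suc (suc k)) P (m ∷ U ++ L) ≡ ballot (length U) (length L)
    cases [] {l ∷ L} p B = trans (cong₂ _+_ (max-zero B (here refl)) (lows [] p B)) (sym (ballot-0 (length L)))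
    cases (c ∷ U) {L} p B = begin
      completions (suc (suc k)) P (m ∷ c ∷ U ++ L)
        ≡⟨ top-sum (suc k) P m c U L desc-m (up ∘ there) ⟩
      F m + (F c + sumOver L F)
        ≡⟨ cong₂ _+_ (max-zero B (here refl)) (cong₂ _+_
             (trans (branch-second (suc k) P desc-m λ s b<c c<c′ → contradiction c<c′ (ℕ.<⇒≯ (closed s b<c (here refl))))
               (blocked-count k (ℕ.suc-injective p) (blocked-top B)))
             (lows (c ∷ U) p B)) ⟩
      ballot (length U) (length L) + ballots (suc (length U)) (length L)
        ≡⟨ ballot-suc (length U) (length L) ⟨
      ballot (suc (length U)) (length L) ∎
      where
      open ≡-Reasoning
      open Blocked B hiding (c)
      F = branch (suc k) P (m ∷ c ∷ U ++ L)

  -- One gap and no low letters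

  -- No letter of P separates two unused letters, except possibly the largest one from the others.
  record Gap (P H : List ℕ) : Set where
    field
      desc   : Descending (H ++ [])
      up     : ∀ {u} → u ∈ H → ∃[ x ] x ∈ P × x < u
      ascent : ∀ {c b} → c ∷ b ∷ [] ⊆ P → b < c → ∀ {h} → h ∈ H → c < h → ∀ {z} → z ∈ H → b < z
      gap    : ∀ {p} → p ∈ P → ∀ {h z} → h ∈ H → z ∈ H → p < h → p < z ⊎ (∀ {y} → y ∈ H → y ≤ h)

  ∈-++[] : ∀ {x : ℕ} {H} → x ∈ H ++ [] → x ∈ H
  ∈-++[] {H = H} i with ∈-++⁻ H i
  ... | inj₁ j = j

  module _ {P m H} (G : Gap P (m ∷ H)) where
    open Gap G

    gap-max : Gap (m ∷ P) H
    gap-max = record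
      { desc   = AllPairs.tail desc
      ; up     = λ i → let x , j , x<u = up (there i) in x , there j , x<u
      ; ascent = λ { (_ ∷ʳ s) b<c i c<h j → ascent s b<c (there i) c<h (there j)
                   ; (refl ∷ s) _ i m<h → contradiction m<h (ℕ.<⇒≯ (m> i)) }
      ; gap    = λ { (here refl) i j m<h → contradiction m<h (ℕ.<⇒≯ (m> i))
                   ; (there k) i j p<h → map₂ (λ f {y} i → f (there i)) (gap k (there i) (there j) p<h) }
      }
      where
      m> : ∀ {h} → h ∈ H → h < m
      m> i = All.lookup (AllPairs.head desc) (∈-++⁺ˡ i)

  module _ {P m c H} (G : Gap P (m ∷ c ∷ H)) where
    open Gap G

    gap-second : Gap (c ∷ P) (m ∷ H)
    gap-second = record
      { desc   = descending-⊆ (refl ∷ (c ∷ʳ ⊆-refl)) desc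
      ; up     = λ i → let x , j , x<u = up (inside i) in x , there j , x<u
      ; ascent = ascent′
      ; gap    = λ { (here refl) (here refl) j c<h → inj₂ m-max
                   ; (here refl) (there i) j c<h → contradiction c<h (ℕ.<⇒≯ (c> i))
                   ; (there k) i j p<h → map₂ (λ f {y} i → f (inside i)) (gap k (inside i) (inside j) p<h) }
      }
      where
      inside : ∀ {h} → h ∈ m ∷ H → h ∈ m ∷ c ∷ H
      inside (here p)  = here p
      inside (there i) = there (there i)
      c> : ∀ {h} → h ∈ H → h < c
      c> i = All.lookup (AllPairs.head (AllPairs.tail desc)) (∈-++⁺ˡ i)
      m-max : ∀ {y} → y ∈ m ∷ H → y ≤ m
      m-max (here refl) = ℕ.≤-refl
      m-max (there i)   = ℕ.<⇒≤ (All.lookup (AllPairs.head desc) (there (∈-++⁺ˡ i)))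
      c<m : c < m
      c<m = All.lookup (AllPairs.head desc) (here refl)
      ascent′ : ∀ {d b} → d ∷ b ∷ [] ⊆ c ∷ P → b < d → ∀ {h} → h ∈ m ∷ H → d < h → ∀ {z} → z ∈ m ∷ H → b < z
      ascent′ (_ ∷ʳ s)   b<d i d<h j = ascent s b<d (inside i) d<h (inside j)
      -- As `m` exceeds `c`, the exception for the largest letter does not apply, and `b` lies below
      -- the whole gap.
      ascent′ (refl ∷ s) b<c i _   j with gap (to∈ s) (there (here refl)) (inside j) b<c
      ... | inj₁ b<z = b<z
      ... | inj₂ c-max = contradiction (c-max (here refl)) (ℕ.<⇒≱ c<m)

  gap-count : ∀ k {P m H} → length H ≡ k → Gap P (m ∷ H) → completions (suc k) P ((m ∷ H) ++ []) ≡ 2 ^ k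
  gap-count zero    {P} {m} {[]}    refl G = trans (ℕ.+-identityʳ _) (branch-max 0 P ([] ∷ []) λ _ _ _ ())
  gap-count (suc k) {P} {m} {c ∷ H} p    G = begin
    completions (suc (suc k)) P (m ∷ c ∷ H ++ [])
      ≡⟨ top-sum (suc k) P m c H [] desc (up ∘ there ∘ there) ⟩
    F m + (F c + 0)
      ≡⟨ cong₂ (λ x y → x + (y + 0))
           (trans (branch-max (suc k) P desc (λ s b<c c<m i → ascent s b<c (here refl) c<m (there (∈-++[] i))))
             (gap-count k (ℕ.suc-injective p) (gap-max G)))
           (trans (branch-second (suc k) P desc
               (λ s b<c c<d i → ascent s b<c (there (here refl)) c<d (inside i)))
             (gap-count k (ℕ.suc-injective p) (gap-second G))) ⟩
    2 ^ suc k ∎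
    where
    open ≡-Reasoning
    open Gap G
    F = branch (suc k) P (m ∷ c ∷ H ++ [])
    inside : ∀ {h} → h ∈ m ∷ H ++ [] → h ∈ m ∷ c ∷ H
    inside (here p)  = here p
    inside (there i) = there (there (∈-++[] i))

  -- A skipped letter that may still be read early

  -- The letter m has been skipped, and the other unused letters above the minimum of P lie in one gap of P.
  record Waiting (P : List ℕ) (m : ℕ) (H L : List ℕ) : Set where
    field
      base   : Base P H L
      top    : ∀ {r} → r ∈ H ++ L → r < m
      c b    : ℕ
      ascent : c ∷ b ∷ [] ⊆ P
      b<c    : b < c
      c<m    : c < m
      low<b  : ∀ {l} → l ∈ L → l < b
      inner  : ∀ {c b} → c ∷ b ∷ [] ⊆ P → b < c → c < m → ∀ {h} → h ∈ H → b < h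
      gap    : ∀ {p} → p ∈ P → ∀ {h z} → h ∈ H → z ∈ H → p < h → p < z
    open Base base public

    desc-m : Descending (m ∷ H ++ L)
    desc-m = All.tabulate top ∷ desc

    max-gap : ∀ {h H′} → H ≡ h ∷ H′ → L ≡ [] → Gap (m ∷ P) H
    max-gap {h} {H′} refl refl = record
      { desc   = desc
      ; up     = λ i → let x , j , x<u = up i in x , there j , x<u
      ; ascent = λ { (_ ∷ʳ s) b<c i c<h j → contradiction c<h (ℕ.<⇒≯ (closed s b<c (∈-++⁺ˡ i)))
                   ; (refl ∷ s) _ i m<h → contradiction m<h (ℕ.<⇒≯ (top (∈-++⁺ˡ i))) }
      ; gap    = λ { (here refl) i j m<h → contradiction m<h (ℕ.<⇒≯ (top (∈-++⁺ˡ i)))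
                   ; (there k) i j p<h → inj₁ (gap k i j p<h) }
      }

  waiting-top : ∀ {P m c H L} → Waiting P m (c ∷ H) L → Waiting (c ∷ P) m H L
  waiting-top {P} {m} {c} {H} {L} W = record
    { base = base-top base ; top = top ∘ there
    ; ascent = c ∷ʳ ascent ; b<c = b<c ; c<m = c<m ; low<b = low<b
    ; inner = λ { (_ ∷ʳ s) b<c c<m i → inner s b<c c<m (there i)
                ; (refl ∷ s) b<c _ i → gap (to∈ s) (here refl) (there i) b<c }
    ; gap   = λ { (here refl) i j c<h → contradiction c<h (ℕ.<⇒≯ (All.lookup (AllPairs.head desc) (∈-++⁺ˡ i)))
                ; (there k) i j p<h → gap k (there i) (there j) p<h }
    }
    where open Waiting W hiding (c)

  waiting-lowest : ∀ {P m H l L} → Waiting P m H (l ∷ L) → Waiting (l ∷ P) m H L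
  waiting-lowest {P} {m} {H} {l} {L} W = record
    { base = subst (λ H → Base (l ∷ P) H L) (++-identityʳ H) (base-low [] base)
    ; top = top ∘ lookup (++⁺ (⊆-refl {x = H}) (l ∷ʳ ⊆-refl))
    ; ascent = l ∷ʳ ascent ; b<c = b<c ; c<m = c<m ; low<b = low<b ∘ there
    ; inner = λ { (_ ∷ʳ s) → inner s ; (refl ∷ s) b<l → contradiction b<l (ℕ.<⇒≯ (low (here refl) (to∈ s))) }
    ; gap   = λ { (here refl) i j l<h → cross H desc j (here refl) ; (there k) → gap k }
    }
    where open Waiting W

  -- The letters `l₁ ∷ L₁` are now above the minimum but still below `b`, so they keep `m` blocked;
  -- `l₁` serves as witness for all of `H`.
  waiting-low : ∀ {P m H} l₁ L₁ {l L₂} → Waiting P m H (l₁ ∷ L₁ ++ l ∷ L₂) → Blocked (l ∷ P) m (H ++ l₁ ∷ L₁) L₂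
  waiting-low {P} {m} {H} l₁ L₁ {l} {L₂} W = record
    { base = base-low (l₁ ∷ L₁) base ; top = top ∘ lookup (low-⊆ H (l₁ ∷ L₁))
    ; ascent = l ∷ʳ ascent ; b<c = b<c ; c<m = c<m ; low<b = low<b ∘ there ∘ ∈-++⁺ʳ L₁ ∘ there
    ; coinitial = coinitial }
    where
    open Waiting W
    coinitial : ∀ {u} → u ∈ H ++ l₁ ∷ L₁ → ∃[ z ] z ∈ H ++ l₁ ∷ L₁ × z ≤ u × z < b
    coinitial i with ∈-++⁻ H i
    ... | inj₁ j = l₁ , ∈-++⁺ʳ H (here refl) , ℕ.<⇒≤ (cross H desc j (here refl)) , low<b (here refl)
    ... | inj₂ j = _ , i , ℕ.≤-refl , low<b (∈-++⁺ˡ j)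

  -- Low letters block `m`, and opening a lower gap blocks it for good. Surplus therefore starts
  -- only when `L` is exhausted: reading `m` then leaves one gap without low letters, which
  -- `gap-count` covers.
  waiting-count : ∀ k {P m H L} → length (H ++ L) ≡ k → Waiting P m H L →
    completions (suc k) P (m ∷ H ++ L) ≡ ballot (length H) (length L) + surplus (length H) (length L)
  waiting-count zero {P} {m} {[]} {[]} p W = trans (ℕ.+-identityʳ _) (branch-max 0 P ([] ∷ []) λ _ _ _ ())
  waiting-count (suc k) {P} {m} {H} {L} p W = cases H L p W
    where
    open ≡-Reasoning
    open ℕ-Solver
    step-c : ∀ {c H L} → length (H ++ L) ≡ k → Waiting P m (c ∷ H) L →
      branch (suc k) P (m ∷ c ∷ H ++ L) c ≡ ballot (length H) (length L) + surplus (length H) (length L)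
    step-c p W = trans (branch-second (suc k) P desc-m λ s b<c c<c′ → contradiction c<c′ (ℕ.<⇒≯ (closed s b<c (here refl))))
      (waiting-count k p (waiting-top W))
      where open Waiting W
    max-zero : ∀ H {l L} → Waiting P m H (l ∷ L) → branch (suc k) P (m ∷ H ++ l ∷ L) m ≡ 0
    max-zero H W = branch-max-blocked (suc k) P desc-m ascent b<c c<m (∈-++⁺ʳ H (here refl)) (low<b (here refl))
      where open Waiting W
    after-low : ℕ → ℕ → ℕ → ℕ
    after-low h zero    s = ballot h s + surplus h s
    after-low h (suc u) s = ballot (h + suc u) s
    lows : ∀ H {l L} → length (H ++ l ∷ L) ≡ suc k → Waiting P m H (l ∷ L) →
      sumOver (l ∷ L) (branch (suc k) P (m ∷ H ++ l ∷ L)) ≡ surplus (length H) (length L) + ballots (length H) (suc (length L))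
    lows H {l} {L} p W = trans
      (low-sum (suc k) P (m ∷ H) (l ∷ L) (after-low h) (Waiting.desc-m W) (Waiting.low W) λ
        { []        refl → trans (cong (λ H → completions (suc k) (l ∷ P) (m ∷ H ++ L)) (++-identityʳ H))
            (waiting-count k (trans (cong (λ H → length (H ++ L)) (sym (++-identityʳ H))) (low-length H [] l L k p)) (waiting-lowest W))
        ; (l₁ ∷ L₁) {l′} {L₂} refl → trans (blocked-count k (low-length H (l₁ ∷ L₁) l′ L₂ k p) (waiting-low l₁ L₁ W))
            (cong (λ n → ballot n (length L₂)) (length-++ H)) })
      (trans (cong (_+ antidiagonal (λ u → ballot (h + suc u)) s)
          (trans (ℕ.+-comm (ballot h s) _) (cong (λ a → surplus h s + ballot a s) (sym (ℕ.+-identityʳ h)))))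
        (ℕ.+-assoc (surplus h s) _ _))
      where
      h = length H
      s = length L
    cases : ∀ H L → length (H ++ L) ≡ suc k → Waiting P m H L →
      completions (suc (suc k)) P (m ∷ H ++ L) ≡ ballot (length H) (length L) + surplus (length H) (length L)
    cases [] (l ∷ L) p W = trans (cong₂ _+_ (max-zero [] W) (lows [] p W))
      (trans (sym (ballot-0 (length L))) (sym (ℕ.+-identityʳ _)))
    cases (c ∷ H) [] p W = begin
      completions (suc (suc k)) P (m ∷ c ∷ H ++ [])
        ≡⟨ top-sum (suc k) P m c H [] desc-m (up ∘ there) ⟩
      F m + (F c + 0)
        ≡⟨ cong₂ (λ x y → x + (y + 0))
             (trans (branch-max (suc k) P desc-m λ s b<c c<m → inner s b<c c<m ∘ ∈-++[])
               (trans (gap-count k H-length (max-gap refl refl)) (cong (2 ^_) (sym H-length))))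
             (step-c (ℕ.suc-injective p) W) ⟩
      2 ^ h + (1 + surplus h 0 + 0)
        ≡⟨ solve 2 (λ a b → a :+ (con 1 :+ b :+ con 0) := con 1 :+ (b :+ a)) refl (2 ^ h) (surplus h 0) ⟩
      1 + (surplus h 0 + 2 ^ h) ∎
      where
      open Waiting W hiding (c)
      h = length H
      H-length : length H ≡ k
      H-length = ℕ.suc-injective (trans (cong (suc ∘ length) (sym (++-identityʳ H))) p)
      F = branch (suc k) P (m ∷ c ∷ H ++ [])
    cases (c ∷ H) (l ∷ L) p W = begin
      completions (suc (suc k)) P (m ∷ c ∷ H ++ l ∷ L)
        ≡⟨ top-sum (suc k) P m c H (l ∷ L) desc-m (up ∘ there) ⟩
      F m + (F c + sumOver (l ∷ L) F)
        ≡⟨ cong₂ _+_ (max-zero (c ∷ H) W) (cong₂ _+_ (step-c (ℕ.suc-injective p) W) (lows (c ∷ H) p W)) ⟩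
      ballot h (suc s) + surplus h (suc s) + (surplus (suc h) s + ballots (suc h) (suc s))
        ≡⟨ solve 4 (λ a b c d → a :+ b :+ (c :+ d) := a :+ d :+ (c :+ b)) refl
             (ballot h (suc s)) (surplus h (suc s)) (surplus (suc h) s) (ballots (suc h) (suc s)) ⟩
      ballot h (suc s) + ballots (suc h) (suc s) + (surplus (suc h) s + surplus h (suc s))
        ≡⟨ cong (_+ (surplus (suc h) s + surplus h (suc s))) (ballot-suc h (suc s)) ⟨
      ballot (suc h) (suc s) + surplus (suc h) (suc s) ∎
      where
      open Waiting W hiding (c)
      h = length H
      s = length L
      F = branch (suc k) P (m ∷ c ∷ H ++ l ∷ L)

  -- No letter skipped so far

  -- No letter has been skipped, and U₂ is the lowest nonempty gap of P above its minimum.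
  record Clean (P U₁ U₂ L : List ℕ) : Set where
    field
      base : Base P (U₁ ++ U₂) L
      sep  : ∀ {u v} → u ∈ U₁ → v ∈ U₂ → ∃[ p ] p ∈ P × v < p × p < u
      gap  : ∀ {p} → p ∈ P → ∀ {u v} → u ∈ U₂ → v ∈ U₂ → p < u → p < v
      last : U₂ ≡ [] → U₁ ≡ []
    open Base base public

    no-ascent : ∀ {r} → r ∈ (U₁ ++ U₂) ++ L → ∀ {c b} → c ∷ b ∷ [] ⊆ P → b < c → c < r → ∀ {A : Set} → A
    no-ascent i s b<c c<r = contradiction c<r (ℕ.<⇒≯ (closed s b<c i))

  clean-max₁ : ∀ {P m U₁ v U₂ L} → Clean P (m ∷ U₁) (v ∷ U₂) L → Clean (m ∷ P) U₁ (v ∷ U₂) L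
  clean-max₁ {P} {m} {U₁} K = record
    { base = base-top base
    ; sep  = λ i j → let p , k , v<p , p<u = sep (there i) j in p , there k , v<p , p<u
    ; gap  = λ { (here refl) i j m<u → contradiction m<u (ℕ.<⇒≯ (All.lookup (AllPairs.head desc) (∈-++⁺ˡ (∈-++⁺ʳ U₁ i))))
               ; (there k) → gap k }
    ; last = λ ()
    }
    where open Clean K

  clean-max₂ : ∀ {P m U₂ L} → Clean P [] (m ∷ U₂) L → Clean (m ∷ P) [] U₂ L
  clean-max₂ K = record
    { base = base-top base
    ; sep  = λ ()
    ; gap  = λ { (here refl) i j m<u → contradiction m<u (ℕ.<⇒≯ (All.lookup (AllPairs.head desc) (∈-++⁺ˡ i)))
               ; (there k) i j → gap k (there i) (there j) }
    ; last = λ _ → refl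
    }
    where open Clean K

  clean-lowest : ∀ {P U₁ U₂ l L} → Clean P U₁ U₂ (l ∷ L) → Clean (l ∷ P) U₁ U₂ L
  clean-lowest {P} {U₁} {U₂} {l} {L} K = record
    { base = subst (λ U → Base (l ∷ P) U L) (++-identityʳ (U₁ ++ U₂)) (base-low [] base)
    ; sep  = λ i j → let p , k , v<p , p<u = sep i j in p , there k , v<p , p<u
    ; gap  = λ { (here refl) i j l<u → cross (U₁ ++ U₂) desc (∈-++⁺ʳ U₁ j) (here refl) ; (there k) → gap k }
    ; last = last
    }
    where open Clean K

  clean-low : ∀ {P U₁ U₂} l₁ L₁ {l L₂} → Clean P U₁ U₂ (l₁ ∷ L₁ ++ l ∷ L₂) →
    Clean (l ∷ P) (U₁ ++ U₂) (l₁ ∷ L₁) L₂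
  clean-low {P} {U₁} {U₂} l₁ L₁ {l} {L₂} K = record
    { base = base-low (l₁ ∷ L₁) base
    ; sep  = λ i j → let x , k , x<u = up i in x , there k , low (∈-++⁺ˡ j) k , x<u
    ; gap  = λ { (here refl) i j l<u → cross (l₁ ∷ L₁) (descending-⊆ (++⁺ (minimum (U₁ ++ U₂)) ⊆-refl) desc) j (here refl)
               ; (there k) i j p<u → contradiction p<u (ℕ.<⇒≯ (low (∈-++⁺ˡ i) k)) }
    ; last = λ ()
    }
    where
    open Clean K

  -- The gap condition leaves out `m`, so this covers both `m` in the same gap as `c` and `m` alone
  -- in the higher gaps. Any letter read below `c` starts the ascent, and it lies below `H` too.
  skip-waiting : ∀ {P m c H L} → Base P (m ∷ c ∷ H) L →
    (∀ {p} → p ∈ P → ∀ {u v} → u ∈ c ∷ H → v ∈ c ∷ H → p < u → p < v) → Waiting (c ∷ P) m H L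
  skip-waiting {P} {m} {c} {H} {L} B gap = record
    { base   = base-top (base-tail B)
    ; top    = λ i → All.lookup (AllPairs.head desc) (there i)
    ; ascent = refl ∷ from∈ (proj₁ (proj₂ below))
    ; b<c    = proj₂ (proj₂ below)
    ; c<m    = c<m
    ; low<b  = λ i → low i (proj₁ (proj₂ below))
    ; inner  = λ { (_ ∷ʳ s) b<c c<m → contradiction c<m (ℕ.<⇒≯ (closed s b<c (here refl)))
                 ; (refl ∷ s) b<c _ i → gap (to∈ s) (here refl) (there i) b<c }
    ; gap    = λ { (here refl) i j c<h → contradiction c<h (ℕ.<⇒≯ (All.lookup (AllPairs.head (AllPairs.tail desc)) (∈-++⁺ˡ i)))
                 ; (there k) i j → gap k (there i) (there j) }
    }
    where
    open Base B
    below : ∃[ x ] x ∈ P × x < c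
    below = up (there (here refl))
    c<m : c < m
    c<m = All.lookup (AllPairs.head desc) (here refl)

  skip-blocked : ∀ {P m c U₁ v U₂ L} → Clean P (m ∷ c ∷ U₁) (v ∷ U₂) L → Blocked (c ∷ P) m (U₁ ++ v ∷ U₂) L
  skip-blocked {P} {m} {c} {U₁} {v} {U₂} {L} K = record
    { base   = base-top (base-tail base)
    ; top    = λ i → All.lookup (AllPairs.head desc) (there i)
    ; ascent = refl ∷ from∈ (proj₁ (proj₂ between))
    ; b<c    = proj₂ (proj₂ (proj₂ between))
    ; c<m    = All.lookup (AllPairs.head desc) (here refl)
    ; low<b  = λ i → low i (proj₁ (proj₂ between))
    ; coinitial = coinitial
    }
    where
    open Clean K
    U-desc : Descending (U₁ ++ v ∷ U₂)
    U-desc = descending-⊆ (m ∷ʳ (c ∷ʳ ⊆-trans (⊆-reflexive (sym (++-identityʳ _))) (++⁺ ⊆-refl (minimum L)))) desc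
    between : ∃[ p ] p ∈ P × v < p × p < c
    between = sep (there (here refl)) (here refl)
    b : ℕ
    b = proj₁ between
    v<b : v < b
    v<b = proj₁ (proj₂ (proj₂ between))
    v-max : ∀ {z} → z ∈ v ∷ U₂ → z ≤ v
    v-max (here refl) = ℕ.≤-refl
    v-max (there i)   = ℕ.<⇒≤ (All.lookup (AllPairs.head v-desc) i)
      where
      v-desc : Descending (v ∷ U₂)
      v-desc = descending-⊆ (++⁺ (minimum U₁) ⊆-refl) U-desc
    coinitial : ∀ {u} → u ∈ U₁ ++ v ∷ U₂ → ∃[ z ] z ∈ U₁ ++ v ∷ U₂ × z ≤ u × z < b
    coinitial i with ∈-++⁻ U₁ i
    ... | inj₁ j = v , ∈-++⁺ʳ U₁ (here refl) , ℕ.<⇒≤ (cross U₁ U-desc j (here refl)) , v<b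
    ... | inj₂ j = _ , i , ℕ.≤-refl , ℕ.≤-<-trans (v-max j) v<b

  delayed : (ℕ → ℕ) → ℕ → ℕ
  delayed f zero    = 0
  delayed f (suc s) = f s

  gapPart-0 : ∀ b s → gapPart 0 (suc (suc b)) s ≡ delayed (gapPart 0 (suc (suc b))) s + (gapPart 0 (suc b) s + surplus b s)
  gapPart-0 b zero    = refl
  gapPart-0 b (suc s) = refl

  gapPart-1 : ∀ b s → gapPart 1 (suc b) s ≡ delayed (gapPart 1 (suc b)) s + (gapPart 0 (suc b) s + surplus b s)
  gapPart-1 b zero    = refl
  gapPart-1 b (suc s) = refl

  gapPart-2 : ∀ a b s → gapPart (suc (suc a)) b s ≡ delayed (gapPart (suc (suc a)) b) s + gapPart (suc a) b s
  gapPart-2 a b zero    = refl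
  gapPart-2 a b (suc s) = refl

  -- For `u = 0` the largest low letter is read and the gaps stay as they are. Otherwise the lifted
  -- letters become the lowest gap and all earlier ones count as higher.
  after-low : ℕ → ℕ → ℕ → ℕ → ℕ
  after-low a₁ a₂ zero    s = freePart (a₁ + a₂) s + gapPart a₁ a₂ s
  after-low a₁ a₂ (suc u) s = freePart (a₁ + a₂ + suc u) s + gapPart (a₁ + a₂) (suc u) s

  freePartSum-antidiagonal : ∀ a s → antidiagonal (λ u → freePart (a + suc u)) s ≡ freePartSum (suc a) s
  freePartSum-antidiagonal a zero    = refl
  freePartSum-antidiagonal a (suc s) = cong₂ _+_ (cong (λ b → freePart b s) (ℕ.+-comm a 1))
    (trans (antidiagonal-cong (λ u t → cong (λ b → freePart b t) (ℕ.+-suc a (suc u))) s) (freePartSum-antidiagonal (suc a) s))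

  after-low-sum : ∀ a₁ a₂ s → antidiagonal (after-low a₁ a₂) s ≡
    freePartSum (a₁ + a₂) s + (delayed (gapPart a₁ a₂) s + newGapPart (a₁ + a₂) s)
  after-low-sum a₁ a₂ zero    = refl
  after-low-sum a₁ a₂ (suc s) = trans
    (cong (freePart a s + gapPart a₁ a₂ s +_) (trans (antidiagonal-+ (λ u → freePart (a + suc u)) (gapPart a ∘ suc) s)
      (cong (_+ newGapPart a (suc s)) (freePartSum-antidiagonal a s))))
    (solve 4 (λ f g n x → f :+ g :+ (n :+ x) := f :+ n :+ (g :+ x)) refl
      (freePart a s) (gapPart a₁ a₂ s) (freePartSum (suc a) s) (newGapPart a (suc s)))
    where
    a = a₁ + a₂
    open ℕ-Solver

  clean-count : ∀ k {P} U₁ U₂ L → length ((U₁ ++ U₂) ++ L) ≡ k → Clean P U₁ U₂ L →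
    completions k P ((U₁ ++ U₂) ++ L)
      ≡ freePart (length U₁ + length U₂) (length L) + gapPart (length U₁) (length U₂) (length L)
  clean-count zero        []       []      []      p K = refl
  clean-count (suc k) {P} U₁ U₂ L p K = cases U₁ U₂ L p K
    where
    open ≡-Reasoning
    open ℕ-Solver
    lows : ∀ U₁ U₂ L → length ((U₁ ++ U₂) ++ L) ≡ suc k → Clean P U₁ U₂ L →
      sumOver L (branch k P ((U₁ ++ U₂) ++ L)) ≡
        freePartSum (length U₁ + length U₂) (length L)
        + (delayed (gapPart (length U₁) (length U₂)) (length L) + newGapPart (length U₁ + length U₂) (length L))
    lows U₁ U₂ L p K = trans
      (low-sum k P (U₁ ++ U₂) L (after-low (length U₁) (length U₂)) (Clean.desc K) (Clean.low K) λ
        { [] {l} {L₂} refl → trans (cong (λ U → completions k (l ∷ P) (U ++ L₂)) (++-identityʳ (U₁ ++ U₂)))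
            (clean-count k U₁ U₂ L₂
              (trans (cong (λ U → length (U ++ L₂)) (sym (++-identityʳ (U₁ ++ U₂)))) (low-length (U₁ ++ U₂) [] l L₂ k p))
              (clean-lowest K))
        ; (l₁ ∷ L₁) {l} {L₂} refl → trans
            (clean-count k (U₁ ++ U₂) (l₁ ∷ L₁) L₂ (low-length (U₁ ++ U₂) (l₁ ∷ L₁) l L₂ k p) (clean-low l₁ L₁ K))
            (cong (λ a → freePart (a + suc (length L₁)) (length L₂) + gapPart a (suc (length L₁)) (length L₂)) (length-++ U₁)) })
      (after-low-sum (length U₁) (length U₂) (length L))
    max : ∀ {m R} → Descending (m ∷ R) → (∀ {c b} → c ∷ b ∷ [] ⊆ P → b < c → c < m → ∀ {A : Set} → A) →
      branch k P (m ∷ R) m ≡ completions k (m ∷ P) R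
    max d none = branch-max k P d λ s b<c c<m _ → none s b<c c<m
    second : ∀ {m c R} → Descending (m ∷ c ∷ R) → (∀ {d b} → d ∷ b ∷ [] ⊆ P → b < d → d < c → ∀ {A : Set} → A) →
      branch k P (m ∷ c ∷ R) c ≡ completions k (c ∷ P) (m ∷ R)
    second d none = branch-second k P d λ s b<c c<m _ → none s b<c c<m
    cases : ∀ U₁ U₂ L → length ((U₁ ++ U₂) ++ L) ≡ suc k → Clean P U₁ U₂ L →
      completions (suc k) P ((U₁ ++ U₂) ++ L)
        ≡ freePart (length U₁ + length U₂) (length L) + gapPart (length U₁) (length U₂) (length L)
    -- The condition `last` excludes the junk value of `gapPart`.
    cases (m ∷ U₁) [] L p K with Clean.last K refl
    ... | ()
    cases [] [] (l ∷ L) p K = trans (lows [] [] (l ∷ L) p K) (sym (ℕ.+-identityʳ _))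
    cases [] (m ∷ []) L p K = begin
      F m + sumOver L F
        ≡⟨ cong₂ _+_ (trans (max desc (no-ascent (here refl))) (clean-count k [] [] L (ℕ.suc-injective p) (clean-max₂ K)))
             (lows [] (m ∷ []) L p K) ⟩
      freePart 0 s + 0 + (freePartSum 1 s + (delayed (gapPart 0 1) s + newGapPart 1 s))
        ≡⟨ cong (λ g → freePart 0 s + 0 + (freePartSum 1 s + (g + newGapPart 1 s))) (delayed-0 s) ⟩
      freePart 0 s + 0 + (freePartSum 1 s + (0 + newGapPart 1 s))
        ≡⟨ solve 3 (λ f n x → f :+ con 0 :+ (n :+ (con 0 :+ x)) := n :+ (f :+ x) :+ con 0) refl
             (freePart 0 s) (freePartSum 1 s) (newGapPart 1 s) ⟩
      freePart 1 s + 0 ∎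
      where
      open Clean K
      s = length L
      F = branch k P (m ∷ L)
      delayed-0 : ∀ s → delayed (gapPart 0 1) s ≡ 0
      delayed-0 zero    = refl
      delayed-0 (suc s) = refl
    cases [] (m ∷ c ∷ H) L p K = begin
      completions (suc k) P (m ∷ c ∷ H ++ L)
        ≡⟨ top-sum k P m c H L desc (up ∘ there ∘ there) ⟩
      F m + (F c + sumOver L F)
        ≡⟨ cong₂ _+_ (trans (max desc (no-ascent (here refl))) (clean-count k [] (c ∷ H) L (ℕ.suc-injective p) (clean-max₂ K)))
             (cong₂ _+_ (trans (second desc (no-ascent (there (here refl)))) (waited k (ℕ.suc-injective p)))
               (lows [] (m ∷ c ∷ H) L p K)) ⟩
      freePart (suc h) s + gapPart 0 (suc h) s + (ballot h s + surplus h s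
        + (freePartSum (suc (suc h)) s + (delayed (gapPart 0 (suc (suc h))) s + newGapPart (suc (suc h)) s)))
        ≡⟨ solve 7 (λ f g b e n d x → f :+ g :+ (b :+ e :+ (n :+ (d :+ x))) := n :+ (f :+ (b :+ x)) :+ (d :+ (g :+ e))) refl
             (freePart (suc h) s) (gapPart 0 (suc h) s) (ballot h s) (surplus h s) (freePartSum (suc (suc h)) s)
             (delayed (gapPart 0 (suc (suc h))) s) (newGapPart (suc (suc h)) s) ⟩
      freePart (suc (suc h)) s + (delayed (gapPart 0 (suc (suc h))) s + (gapPart 0 (suc h) s + surplus h s))
        ≡⟨ cong (freePart (suc (suc h)) s +_) (gapPart-0 h s) ⟨
      freePart (suc (suc h)) s + gapPart 0 (suc (suc h)) s ∎
      where
      open Clean K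
      h = length H
      s = length L
      F = branch k P (m ∷ c ∷ H ++ L)
      waited : ∀ k → suc (length (H ++ L)) ≡ k → completions k (c ∷ P) (m ∷ H ++ L) ≡ ballot h s + surplus h s
      waited (suc k) p = waiting-count k (ℕ.suc-injective p)
        (skip-waiting base λ i j j′ → gap i (there j) (there j′))
    cases (m ∷ []) (c ∷ H) L p K = begin
      completions (suc k) P (m ∷ c ∷ H ++ L)
        ≡⟨ top-sum k P m c H L desc (up ∘ there ∘ there) ⟩
      F m + (F c + sumOver L F)
        ≡⟨ cong₂ _+_ (trans (max desc (no-ascent (here refl))) (clean-count k [] (c ∷ H) L (ℕ.suc-injective p) (clean-max₁ K)))
             (cong₂ _+_ (trans (second desc (no-ascent (there (here refl)))) (waited k (ℕ.suc-injective p)))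
               (lows (m ∷ []) (c ∷ H) L p K)) ⟩
      freePart (suc h) s + gapPart 0 (suc h) s + (ballot h s + surplus h s
        + (freePartSum (suc (suc h)) s + (delayed (gapPart 1 (suc h)) s + newGapPart (suc (suc h)) s)))
        ≡⟨ solve 7 (λ f g b e n d x → f :+ g :+ (b :+ e :+ (n :+ (d :+ x))) := n :+ (f :+ (b :+ x)) :+ (d :+ (g :+ e))) refl
             (freePart (suc h) s) (gapPart 0 (suc h) s) (ballot h s) (surplus h s) (freePartSum (suc (suc h)) s)
             (delayed (gapPart 1 (suc h)) s) (newGapPart (suc (suc h)) s) ⟩
      freePart (suc (suc h)) s + (delayed (gapPart 1 (suc h)) s + (gapPart 0 (suc h) s + surplus h s))
        ≡⟨ cong (freePart (suc (suc h)) s +_) (gapPart-1 h s) ⟨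
      freePart (suc (suc h)) s + gapPart 1 (suc h) s ∎
      where
      open Clean K
      h = length H
      s = length L
      F = branch k P (m ∷ c ∷ H ++ L)
      waited : ∀ k → suc (length (H ++ L)) ≡ k → completions k (c ∷ P) (m ∷ H ++ L) ≡ ballot h s + surplus h s
      waited (suc k) p = waiting-count k (ℕ.suc-injective p) (skip-waiting base gap)
    cases (m ∷ c ∷ U₁) (v ∷ U₂) L p K = begin
      completions (suc k) P (m ∷ c ∷ (U₁ ++ v ∷ U₂) ++ L)
        ≡⟨ top-sum k P m c (U₁ ++ v ∷ U₂) L desc (up ∘ there ∘ there) ⟩
      F m + (F c + sumOver L F)
        ≡⟨ cong₂ _+_ (trans (max desc (no-ascent (here refl))) (clean-count k (c ∷ U₁) (v ∷ U₂) L (ℕ.suc-injective p) (clean-max₁ K)))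
             (cong₂ _+_ (trans (second desc (no-ascent (there (here refl)))) (blocked k (ℕ.suc-injective p)))
               (lows (m ∷ c ∷ U₁) (v ∷ U₂) L p K)) ⟩
      freePart (suc a) s + gapPart (suc a₁) a₂ s + (ballot a s
        + (freePartSum (suc (suc a)) s + (delayed (gapPart (suc (suc a₁)) a₂) s + newGapPart (suc (suc a)) s)))
        ≡⟨ solve 6 (λ f g b n d x → f :+ g :+ (b :+ (n :+ (d :+ x))) := n :+ (f :+ (b :+ x)) :+ (d :+ g)) refl
             (freePart (suc a) s) (gapPart (suc a₁) a₂ s) (ballot a s) (freePartSum (suc (suc a)) s)
             (delayed (gapPart (suc (suc a₁)) a₂) s) (newGapPart (suc (suc a)) s) ⟩
      freePart (suc (suc a)) s + (delayed (gapPart (suc (suc a₁)) a₂) s + gapPart (suc a₁) a₂ s)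
        ≡⟨ cong (freePart (suc (suc a)) s +_) (gapPart-2 a₁ a₂ s) ⟨
      freePart (suc (suc a)) s + gapPart (suc (suc a₁)) a₂ s ∎
      where
      open Clean K
      a₁ = length U₁
      a₂ = suc (length U₂)
      a  = a₁ + a₂
      s  = length L
      F  = branch k P (m ∷ c ∷ (U₁ ++ v ∷ U₂) ++ L)
      blocked : ∀ k → suc (length ((U₁ ++ v ∷ U₂) ++ L)) ≡ k →
        completions k (c ∷ P) (m ∷ (U₁ ++ v ∷ U₂) ++ L) ≡ ballot a s
      blocked (suc k) p = trans (blocked-count k (ℕ.suc-injective p) (skip-blocked K))
        (cong (λ n → ballot n s) (length-++ U₁))

  countAvoiders-freePart : ∀ n → countAvoiders Tpat n ≡ freePart 0 n
  countAvoiders-freePart n = begin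
    countAvoiders Tpat n                                    ≡⟨ countAvoiders-completions n ⟩
    completions n [] (downFrom n)                           ≡⟨ clean-count n [] [] (downFrom n) (length-downFrom n) start ⟩
    freePart 0 (length (downFrom n)) + 0                    ≡⟨ ℕ.+-identityʳ _ ⟩
    freePart 0 (length (downFrom n))                        ≡⟨ cong (freePart 0) (length-downFrom n) ⟩
    freePart 0 n                                            ∎
    where
    open ≡-Reasoning
    start : Clean [] [] [] (downFrom n)
    start = record
      { base = record
        { desc = applyDownFrom⁺₁ id n (λ j<i _ → j<i) ; up = λ () ; low = λ _ () ; closed = λ () }
      ; sep = λ () ; gap = λ () ; last = λ _ → refl }

module Generating where

  open import Data.Integer using (ℤ; +_; 0ℤ; 1ℤ)

  -- The ring of formal power series

  module SeriesRing where

    infix 4 _≈_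

    record _≈_ (f g : Series) : Set where
      constructor pointwise
      field at : ∀ n → f n ≡ g n
    open _≈_ public

    ≈-isEquivalence : IsEquivalence _≈_
    ≈-isEquivalence = record
      { refl  = pointwise λ _ → refl
      ; sym   = λ p → pointwise λ n → ≡.sym (at p n)
      ; trans = λ p q → pointwise λ n → ≡.trans (at p n) (at q n)
      }

    seriesSetoid : Setoid _ _
    seriesSetoid = record { isEquivalence = ≈-isEquivalence }

    open Setoid seriesSetoid public using () renaming (refl to ≈-refl; sym to ≈-sym; trans to ≈-trans)

    const : ℤ → Series
    const c = poly (c ∷ [])

    ⊝_ : Series → Series
    (⊝ f) n = ℤ.- f n

    tail : Series → Series
    tail f n = f (suc n)

    ⊗-expand : ∀ f g n → (f ⊗ g) n ≡ foldr ℤ._+_ (+ 0) (applyUpTo (λ i → f i ℤ.* g (n ℕ.∸ i)) (suc n))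
    ⊗-expand f g n = cong (foldr ℤ._+_ (+ 0)) (map-upTo (λ i → f i ℤ.* g (n ℕ.∸ i)) (suc n))

    ⊗-zero : ∀ f g → (f ⊗ g) 0 ≡ f 0 ℤ.* g 0
    ⊗-zero f g = ℤ.+-identityʳ _

    ⊗-suc : ∀ f g n → (f ⊗ g) (suc n) ≡ f 0 ℤ.* g (suc n) ℤ.+ (tail f ⊗ g) n
    ⊗-suc f g n = ≡.trans (⊗-expand f g (suc n)) (cong (λ z → f 0 ℤ.* g (suc n) ℤ.+ z) (≡.sym (⊗-expand (tail f) g n)))

    open ℤ-Solver using (solve; _:=_; _:+_; _:*_; con)

    ⊗-sucʳ : ∀ n f g → (f ⊗ g) (suc n) ≡ f (suc n) ℤ.* g 0 ℤ.+ (f ⊗ tail g) n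
    ⊗-sucʳ zero f g rewrite ⊗-suc f g 0 | ⊗-zero (tail f) g | ⊗-zero f (tail g) = ℤ.+-comm (f 0 ℤ.* g 1) _
    ⊗-sucʳ (suc n) f g rewrite ⊗-suc f g (suc n) | ⊗-sucʳ n (tail f) g | ⊗-suc f (tail g) n =
      solve 3 (λ a b c → a :+ (b :+ c) := b :+ (a :+ c)) refl
        (f 0 ℤ.* g (suc (suc n))) (f (suc (suc n)) ℤ.* g 0) ((tail f ⊗ tail g) n)

    ⊗-congₙ : ∀ n f f′ g g′ → f ≈ f′ → g ≈ g′ → (f ⊗ g) n ≡ (f′ ⊗ g′) n
    ⊗-congₙ zero f f′ g g′ p q rewrite ⊗-zero f g | ⊗-zero f′ g′ = cong₂ ℤ._*_ (at p 0) (at q 0)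
    ⊗-congₙ (suc n) f f′ g g′ p q rewrite ⊗-suc f g n | ⊗-suc f′ g′ n =
      cong₂ ℤ._+_ (cong₂ ℤ._*_ (at p 0) (at q (suc n)))
        (⊗-congₙ n (tail f) (tail f′) g g′ (pointwise λ i → at p (suc i)) q)

    ⊗-congˡ : ∀ {f f′} g → f ≈ f′ → f ⊗ g ≈ f′ ⊗ g
    ⊗-congˡ {f} {f′} g p = pointwise λ n → ⊗-congₙ n f f′ g g p ≈-refl

    ⊗-commₙ : ∀ n f g → (f ⊗ g) n ≡ (g ⊗ f) n
    ⊗-commₙ zero f g rewrite ⊗-zero f g | ⊗-zero g f = ℤ.*-comm (f 0) (g 0)
    ⊗-commₙ (suc n) f g rewrite ⊗-suc f g n | ⊗-sucʳ n g f =
      cong₂ ℤ._+_ (ℤ.*-comm (f 0) (g (suc n))) (⊗-commₙ n (tail f) g)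

    ⊗-distribʳₙ : ∀ n f g h → ((f ⊕ g) ⊗ h) n ≡ (f ⊗ h) n ℤ.+ (g ⊗ h) n
    ⊗-distribʳₙ zero f g h rewrite ⊗-zero (f ⊕ g) h | ⊗-zero f h | ⊗-zero g h = ℤ.*-distribʳ-+ (h 0) (f 0) (g 0)
    ⊗-distribʳₙ (suc n) f g h
      rewrite ⊗-suc (f ⊕ g) h n | ⊗-suc f h n | ⊗-suc g h n | ⊗-distribʳₙ n (tail f) (tail g) h =
      solve 5 (λ a b c d e → (a :+ b) :* c :+ (d :+ e) := a :* c :+ d :+ (b :* c :+ e)) refl
        (f 0) (g 0) (h (suc n)) ((tail f ⊗ h) n) ((tail g ⊗ h) n)

    scale : ℤ → Series → Series
    scale c f n = c ℤ.* f n

    scale-⊗ₙ : ∀ n c f g → (scale c f ⊗ g) n ≡ c ℤ.* (f ⊗ g) n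
    scale-⊗ₙ zero c f g rewrite ⊗-zero (scale c f) g | ⊗-zero f g = ℤ.*-assoc c (f 0) (g 0)
    scale-⊗ₙ (suc n) c f g rewrite ⊗-suc (scale c f) g n | ⊗-suc f g n | scale-⊗ₙ n c (tail f) g =
      solve 4 (λ c a b d → c :* a :* b :+ c :* d := c :* (a :* b :+ d)) refl c (f 0) (g (suc n)) ((tail f ⊗ g) n)

    -- The tail of `f ⊗ g` is a multiple of `tail g` plus `tail f ⊗ g`; scaling and distributivity
    -- then reduce the claim to a smaller index.
    ⊗-assocₙ : ∀ n f g h → ((f ⊗ g) ⊗ h) n ≡ (f ⊗ (g ⊗ h)) n
    ⊗-assocₙ zero f g h rewrite ⊗-zero (f ⊗ g) h | ⊗-zero f g | ⊗-zero f (g ⊗ h) | ⊗-zero g h =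
      ℤ.*-assoc (f 0) (g 0) (h 0)
    ⊗-assocₙ (suc n) f g h = begin
      ((f ⊗ g) ⊗ h) (suc n)
        ≡⟨ ⊗-suc (f ⊗ g) h n ⟩
      (f ⊗ g) 0 ℤ.* h (suc n) ℤ.+ (tail (f ⊗ g) ⊗ h) n
        ≡⟨ cong₂ ℤ._+_ (cong (ℤ._* h (suc n)) (⊗-zero f g))
             (⊗-congₙ n (tail (f ⊗ g)) (scale (f 0) (tail g) ⊕ (tail f ⊗ g)) h h (pointwise (⊗-suc f g)) ≈-refl) ⟩
      f 0 ℤ.* g 0 ℤ.* h (suc n) ℤ.+ ((scale (f 0) (tail g) ⊕ (tail f ⊗ g)) ⊗ h) n
        ≡⟨ cong (λ z → f 0 ℤ.* g 0 ℤ.* h (suc n) ℤ.+ z) (⊗-distribʳₙ n (scale (f 0) (tail g)) (tail f ⊗ g) h) ⟩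
      f 0 ℤ.* g 0 ℤ.* h (suc n) ℤ.+ ((scale (f 0) (tail g) ⊗ h) n ℤ.+ ((tail f ⊗ g) ⊗ h) n)
        ≡⟨ cong₂ (λ y z → f 0 ℤ.* g 0 ℤ.* h (suc n) ℤ.+ (y ℤ.+ z)) (scale-⊗ₙ n (f 0) (tail g) h) (⊗-assocₙ n (tail f) g h) ⟩
      f 0 ℤ.* g 0 ℤ.* h (suc n) ℤ.+ (f 0 ℤ.* (tail g ⊗ h) n ℤ.+ (tail f ⊗ (g ⊗ h)) n)
        ≡⟨ solve 5 (λ a b c d e → a :* b :* c :+ (a :* d :+ e) := a :* (b :* c :+ d) :+ e) refl
             (f 0) (g 0) (h (suc n)) ((tail g ⊗ h) n) ((tail f ⊗ (g ⊗ h)) n) ⟩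
      f 0 ℤ.* (g 0 ℤ.* h (suc n) ℤ.+ (tail g ⊗ h) n) ℤ.+ (tail f ⊗ (g ⊗ h)) n
        ≡⟨ cong (λ z → f 0 ℤ.* z ℤ.+ (tail f ⊗ (g ⊗ h)) n) (⊗-suc g h n) ⟨
      f 0 ℤ.* (g ⊗ h) (suc n) ℤ.+ (tail f ⊗ (g ⊗ h)) n
        ≡⟨ ⊗-suc f (g ⊗ h) n ⟨
      (f ⊗ (g ⊗ h)) (suc n) ∎
      where open ≡-Reasoning

    zero-⊗ₙ : ∀ n f g → (∀ i → f i ≡ 0ℤ) → (f ⊗ g) n ≡ 0ℤ
    zero-⊗ₙ zero f g p rewrite ⊗-zero f g | p 0 = refl
    zero-⊗ₙ (suc n) f g p rewrite ⊗-suc f g n | p 0 | zero-⊗ₙ n (tail f) g (λ i → p (suc i)) = refl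

    const-⊗ₙ : ∀ n c f → (const c ⊗ f) n ≡ c ℤ.* f n
    const-⊗ₙ zero c f = ⊗-zero (const c) f
    const-⊗ₙ (suc n) c f rewrite ⊗-suc (const c) f n | zero-⊗ₙ n (tail (const c)) f (λ _ → refl) = ℤ.+-identityʳ _

    const-0 : const 0ℤ ≈ (λ _ → 0ℤ)
    const-0 = pointwise λ { zero → refl ; (suc _) → refl }

    neg-⊗ₙ : ∀ n f g → ((⊝ f) ⊗ g) n ≡ ℤ.- (f ⊗ g) n
    neg-⊗ₙ n f g = begin
      ((⊝ f) ⊗ g) n           ≡⟨ ⊗-congₙ n (⊝ f) (scale (ℤ.- 1ℤ) f) g g (pointwise λ i → ≡.sym (ℤ.-1*i≡-i (f i))) ≈-refl ⟩
      (scale (ℤ.- 1ℤ) f ⊗ g) n ≡⟨ scale-⊗ₙ n (ℤ.- 1ℤ) f g ⟩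
      ℤ.- 1ℤ ℤ.* (f ⊗ g) n     ≡⟨ ℤ.-1*i≡-i ((f ⊗ g) n) ⟩
      ℤ.- (f ⊗ g) n            ∎
      where open ≡-Reasoning

    infixl 6 _+_
    infixl 7 _*_
    infix  8 -_

    -- The operations are sealed so that the solver's equations are compared as ring expressions and
    -- not as unfolded convolutions.
    opaque
      _+_ _*_ : Series → Series → Series
      _+_ = _⊕_
      _*_ = _⊗_

      -_ : Series → Series
      -_ = ⊝_

      K : ℤ → Series
      K = const

      X : Series
      X = poly (0ℤ ∷ 1ℤ ∷ [])

    opaque
      unfolding _+_

      +-at : ∀ f g n → (f + g) n ≡ f n ℤ.+ g n
      +-at f g n = refl

      ⊕≈+ : ∀ f g → f ⊕ g ≈ f + g
      ⊕≈+ f g = ≈-refl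

      ⊖≈+- : ∀ f g → f ⊖ g ≈ f + - g
      ⊖≈+- f g = ≈-refl

      ⊗≈* : ∀ f g → f ⊗ g ≈ f * g
      ⊗≈* f g = ≈-refl

      K-at-0 : ∀ c → K c 0 ≡ c
      K-at-0 c = refl

      K-at-suc : ∀ c n → K c (suc n) ≡ 0ℤ
      K-at-suc c n = refl

      isSeriesRing : IsAlmostCommutativeRing _≈_ _+_ _*_ -_ (K 0ℤ) (K 1ℤ)
      isSeriesRing = record
        { isCommutativeSemiring = record
          { isSemiring = record
            { isSemiringWithoutAnnihilatingZero = record
              { +-isCommutativeMonoid = record
                { isMonoid = record
                  { isSemigroup = record
                    { isMagma = record
                      { isEquivalence = ≈-isEquivalence
                      ; ∙-cong = λ p q → pointwise λ n → cong₂ ℤ._+_ (at p n) (at q n) }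
                    ; assoc = λ f g h → pointwise λ n → ℤ.+-assoc (f n) (g n) (h n) }
                  ; identity =
                      (λ f → pointwise λ n → ≡.trans (cong (ℤ._+ f n) (at const-0 n)) (ℤ.+-identityˡ _))
                    , (λ f → pointwise λ n → ≡.trans (cong (ℤ._+_ (f n)) (at const-0 n)) (ℤ.+-identityʳ _)) }
                ; comm = λ f g → pointwise λ n → ℤ.+-comm (f n) (g n) }
              ; *-cong = λ {f} {f′} {g} {g′} p q → pointwise λ n → ⊗-congₙ n f f′ g g′ p q
              ; *-assoc = λ f g h → pointwise λ n → ⊗-assocₙ n f g h
              ; *-identity = one-⊗ , (λ f → ≈-trans (⊗-comm′ f (const 1ℤ)) (one-⊗ f))
              ; distrib = (λ f g h → ≈-trans (⊗-comm′ f (g ⊕ h)) (≈-trans (distrib f g h)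
                            (pointwise λ n → cong₂ ℤ._+_ (⊗-commₙ n g f) (⊗-commₙ n h f))))
                        , distrib }
            ; zero = zeroˡ , (λ f → ≈-trans (⊗-comm′ f (const 0ℤ)) (zeroˡ f)) }
          ; *-comm = ⊗-comm′ }
        ; -‿cong = λ p → pointwise λ n → cong ℤ.-_ (at p n)
        ; -‿*-distribˡ = λ f g → pointwise λ n → neg-⊗ₙ n f g
        ; -‿+-comm = λ f g → pointwise λ n → ≡.sym (ℤ.neg-distrib-+ (f n) (g n)) }
        where
        ⊗-comm′ : ∀ f g → f ⊗ g ≈ g ⊗ f
        ⊗-comm′ f g = pointwise λ n → ⊗-commₙ n f g
        one-⊗ : ∀ f → const 1ℤ ⊗ f ≈ f
        one-⊗ f = pointwise λ n → ≡.trans (const-⊗ₙ n 1ℤ f) (ℤ.*-identityˡ (f n))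
        distrib : ∀ f g h → (g ⊕ h) ⊗ f ≈ (g ⊗ f) ⊕ (h ⊗ f)
        distrib f g h = pointwise λ n → ⊗-distribʳₙ n g h f
        zeroˡ : ∀ f → const 0ℤ ⊗ f ≈ const 0ℤ
        zeroˡ f = pointwise λ n → ≡.trans (const-⊗ₙ n 0ℤ f) (≡.sym (at const-0 n))

    seriesRing : AlmostCommutativeRing _ _
    seriesRing = record { isAlmostCommutativeRing = isSeriesRing }

    opaque
      unfolding _+_

      K-+ : ∀ a b → K (a ℤ.+ b) ≈ K a + K b
      K-+ a b = pointwise λ { zero → refl ; (suc _) → refl }

      K-* : ∀ a b → K (a ℤ.* b) ≈ K a * K b
      K-* a b = pointwise λ
        { zero    → ≡.sym (const-⊗ₙ 0 a (const b))
        ; (suc n) → ≡.sym (≡.trans (const-⊗ₙ (suc n) a (const b)) (ℤ.*-zeroʳ a)) }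

      K-neg : ∀ a → K (ℤ.- a) ≈ - K a
      K-neg a = pointwise λ { zero → refl ; (suc _) → refl }

    KHom : ℤ.+-*-rawRing -Raw-AlmostCommutative⟶ seriesRing
    KHom = record
      { ⟦_⟧ = K ; +-homo = K-+ ; *-homo = K-* ; -‿homo = K-neg ; 0-homo = ≈-refl ; 1-homo = ≈-refl }

    K-≟ : (a b : ℤ) → Maybe (K a ≈ K b)
    K-≟ a b with a ℤ.≟ b
    ... | yes refl = just ≈-refl
    ... | no _     = nothing

    module S = RingSolver ℤ.+-*-rawRing seriesRing KHom K-≟
    module Ring = AlmostCommutativeRing seriesRing using (+-cong; *-cong; -‿cong)

    opaque
      unfolding _+_

      X-*-zero : ∀ f → (X * f) 0 ≡ 0ℤ
      X-*-zero f = ⊗-zero X f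

      X-*-suc : ∀ f n → (X * f) (suc n) ≡ f n
      X-*-suc f n = begin
        (X ⊗ f) (suc n)             ≡⟨ ⊗-suc X f n ⟩
        0ℤ ℤ.+ (tail X ⊗ f) n       ≡⟨ ℤ.+-identityˡ _ ⟩
        (tail X ⊗ f) n              ≡⟨ ⊗-congₙ n (tail X) (const 1ℤ) f f ≈-refl ≈-refl ⟩
        (const 1ℤ ⊗ f) n            ≡⟨ const-⊗ₙ n 1ℤ f ⟩
        1ℤ ℤ.* f n                  ≡⟨ ℤ.*-identityˡ (f n) ⟩
        f n                         ∎
        where open ≡-Reasoning

      poly-[] : poly [] ≈ K 0ℤ
      poly-[] = ≈-sym const-0

      poly-∷ : ∀ a as → poly (a ∷ as) ≈ K a + X * poly as
      poly-∷ a as = pointwise λ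
        { zero    → ≡.sym (≡.trans (cong (λ z → a ℤ.+ z) (X-*-zero (poly as))) (ℤ.+-identityʳ a))
        ; (suc n) → ≡.sym (≡.trans (cong (λ z → 0ℤ ℤ.+ z) (X-*-suc (poly as) n)) (ℤ.+-identityˡ (poly as n))) }

    K-0-at : ∀ n → K 0ℤ n ≡ 0ℤ
    K-0-at zero    = K-at-0 0ℤ
    K-0-at (suc n) = K-at-suc 0ℤ n

  open SeriesRing

  -- Equations modulo known equations, and recurrences as equations of series

  Null : Series → Set
  Null f = f ≈ K 0ℤ

  null-eq : ∀ {l r} → l ≈ r → Null (l + - r)
  null-eq {l} {r} p = ≈-trans (Ring.+-cong p ≈-refl) (S.solve 1 (λ r → r S.:+ S.:- r S.:= S.con 0ℤ) ≈-refl r)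

  null-* : ∀ q {l r} → l ≈ r → Null (q * (l + - r))
  null-* q p = ≈-trans (Ring.*-cong (≈-refl {q}) (null-eq p)) (S.solve 1 (λ q → q S.:* S.con 0ℤ S.:= S.con 0ℤ) ≈-refl q)

  null-+ : ∀ {f g} → Null f → Null g → Null (f + g)
  null-+ p q = ≈-trans (Ring.+-cong p q) (S.solve 0 (S.con 0ℤ S.:+ S.con 0ℤ S.:= S.con 0ℤ) ≈-refl)

  -- This is how cofactors are used: the solver checks an identity of polynomials in which `f` is a
  -- sum of multiples of differences, and known equations make each difference null.
  modulo : ∀ {l r f} → l ≈ r + f → Null f → l ≈ r
  modulo {r = r} p q =
    ≈-trans p (≈-trans (Ring.+-cong ≈-refl q) (S.solve 1 (λ r → r S.:+ S.con 0ℤ S.:= r) ≈-refl r))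


  gf : (ℕ → ℕ) → Series
  gf g n = + g n

  gf-X : ∀ {f g} → f 0 ≡ 0ℤ → (∀ n → f (suc n) ≡ g n) → f ≈ X * g
  gf-X {f} {g} p q = pointwise λ
    { zero    → ≡.trans p (≡.sym (X-*-zero g))
    ; (suc n) → ≡.trans (q n) (≡.sym (X-*-suc g n)) }

  X*+-at-0 : ∀ g h → (X * g + h) 0 ≡ h 0
  X*+-at-0 g h = ≡.trans (+-at (X * g) h 0) (≡.trans (cong (ℤ._+ h 0) (X-*-zero g)) (ℤ.+-identityˡ (h 0)))

  X*+-at-suc : ∀ g h n → (X * g + h) (suc n) ≡ g n ℤ.+ h (suc n)
  X*+-at-suc g h n = ≡.trans (+-at (X * g) h (suc n)) (cong (ℤ._+ h (suc n)) (X-*-suc g n))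

  gf-X+ : ∀ {f g h} → f 0 ≡ h 0 → (∀ n → f (suc n) ≡ g n ℤ.+ h (suc n)) → f ≈ X * g + h
  gf-X+ {f} {g} {h} p q = pointwise λ
    { zero    → ≡.trans p (≡.sym (X*+-at-0 g h))
    ; (suc n) → ≡.trans (q n) (≡.sym (X*+-at-suc g h n)) }

  X-fixpoint-unique : ∀ {u v g} → u ≈ X * u + g → v ≈ X * v + g → u ≈ v
  X-fixpoint-unique {u} {v} {g} p q = pointwise go
    where
    go : ∀ n → u n ≡ v n
    go zero    = ≡.trans (≡.trans (at p 0) (X*+-at-0 u g)) (≡.sym (≡.trans (at q 0) (X*+-at-0 v g)))
    go (suc n) = ≡.trans (≡.trans (at p (suc n)) (X*+-at-suc u g n))
      (≡.trans (cong (ℤ._+ g (suc n)) (go n)) (≡.sym (≡.trans (at q (suc n)) (X*+-at-suc v g n))))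

  -- The factor X lowers the coefficient index and the other term lowers `a`, so lexicographic
  -- induction reaches zero. A guessed closed form is thus correct as soon as its error obeys this
  -- system.
  homogeneous-zero : (P : ℕ → Series) → P 0 ≈ X * P 1 → (∀ a → P (suc a) ≈ X * P (suc (suc a)) + P a) →
    ∀ a → Null (P a)
  homogeneous-zero P p q a = pointwise λ n → ≡.trans (go n a) (≡.sym (K-0-at n))
    where
    go : ∀ n a → P a n ≡ 0ℤ
    go zero    zero    = ≡.trans (at p 0) (X-*-zero (P 1))
    go zero    (suc a) = ≡.trans (≡.trans (at (q a) 0) (X*+-at-0 _ (P a))) (go 0 a)
    go (suc n) zero    = ≡.trans (at p (suc n)) (≡.trans (X-*-suc (P 1) n) (go n 1))
    go (suc n) (suc a) = ≡.trans (at (q a) (suc n))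
      (≡.trans (X*+-at-suc _ (P a) n) (cong₂ ℤ._+_ (go n (suc (suc a))) (go (suc n) a)))

  -- As a series this is the sum of X^(u + 1) times `g u`: the first index is marked by X as well,
  -- and a recurrence in both indices becomes a single equation.
  anti : (ℕ → Series) → Series
  anti g zero    = 0ℤ
  anti g (suc s) = g 0 s ℤ.+ anti (g ∘ suc) s

  gf-antidiagonal : ∀ g → gf (antidiagonal g) ≈ anti (gf ∘ g)
  gf-antidiagonal g = pointwise (go g)
    where
    go : ∀ g n → + antidiagonal g n ≡ anti (gf ∘ g) n
    go g zero    = refl
    go g (suc n) = cong (λ z → + g 0 n ℤ.+ z) (go (g ∘ suc) n)

  anti-unfold : ∀ g → anti g ≈ X * (g 0 + anti (g ∘ suc))
  anti-unfold g = gf-X refl λ n → ≡.sym (+-at (g 0) (anti (g ∘ suc)) n)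

  anti-cong : ∀ {f g} → (∀ u → f u ≈ g u) → anti f ≈ anti g
  anti-cong {f} {g} p = pointwise (λ n → go n f g p)
    where
    go : ∀ n f g → (∀ u → f u ≈ g u) → anti f n ≡ anti g n
    go zero    f g p = refl
    go (suc n) f g p = cong₂ ℤ._+_ (at (p 0) n) (go n (f ∘ suc) (g ∘ suc) (p ∘ suc))

  anti-+ : ∀ f g → anti (λ u → f u + g u) ≈ anti f + anti g
  anti-+ f g = pointwise (λ n → ≡.trans (go n f g) (≡.sym (+-at (anti f) (anti g) n)))
    where
    go : ∀ n f g → anti (λ u → f u + g u) n ≡ anti f n ℤ.+ anti g n
    go zero    f g = refl
    go (suc n) f g rewrite +-at (f 0) (g 0) n | go n (f ∘ suc) (g ∘ suc) =
      ℤ-Solver.solve 4 (λ a b c d → a ℤ-Solver.:+ b ℤ-Solver.:+ (c ℤ-Solver.:+ d)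
          ℤ-Solver.:= a ℤ-Solver.:+ c ℤ-Solver.:+ (b ℤ-Solver.:+ d)) refl
        (f 0 n) (g 0 n) (anti (f ∘ suc) n) (anti (g ∘ suc) n)

  anti-X : ∀ g → anti (λ u → X * g u) ≈ X * anti g
  anti-X g = gf-X refl (λ n → go n g)
    where
    go : ∀ n g → anti (λ u → X * g u) (suc n) ≡ anti g n
    go zero    g rewrite X-*-zero (g 0) = refl
    go (suc n) g = cong₂ ℤ._+_ (X-*-suc (g 0) n) (go n (g ∘ suc))

  anti-X+ : ∀ {f g h} → (∀ u → f u ≈ X * g u + h u) → anti f ≈ X * anti g + anti h
  anti-X+ {f} {g} {h} p = ≈-trans (anti-cong p)
    (≈-trans (anti-+ (λ u → X * g u) h) (Ring.+-cong (anti-X g) ≈-refl))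

  -- The rational series of the surplus and of the gap parts

  surplusGF : Series
  surplusGF = anti (gf ∘ surplus)

  -- In the solver's letters, e = X e′ because `surplus` vanishes for `zero`; the powers of two
  -- enter at s = 0 only, hence as constants, with d = X / (1 - 2 X); and (1 - X) e′ = e + d.
  surplus-eq : (K (+ 1) + - (K (+ 2) * X)) * ((K (+ 1) + - (K (+ 2) * X)) * surplusGF) ≈ X * X
  surplus-eq = modulo
    (S.solve 4 (λ X e e′ d →
       let open S; y = con 1ℤ :+ :- (con (+ 2) :* X) in
       y :* (y :* e) := X :* X
         :+ (((con 1ℤ :+ :- X) :* y) :* (e :+ :- (X :* (con 0ℤ :+ e′)))
         :+ ((X :* y) :* (e′ :+ :- (X :* e′ :+ (e :+ d)))
         :+ X :* (d :+ :- (X :* (con 1ℤ :+ (d :+ d)))))))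
       ≈-refl X surplusGF (anti (gf ∘ surplus ∘ suc)) (anti powers))
    (null-+ (null-* _ e-eq) (null-+ (null-* _ e′-eq) (null-* _ d-eq)))
    where
    powers : ℕ → Series
    powers h = K (+ (2 ℕ.^ h))
    double : ∀ u → powers (suc u) ≈ powers u + powers u
    double u rewrite ℕ.+-identityʳ (2 ℕ.^ u) = K-+ (+ (2 ℕ.^ u)) (+ (2 ℕ.^ u))
    d-eq : anti powers ≈ X * (K 1ℤ + (anti powers + anti powers))
    d-eq = ≈-trans (anti-unfold powers) (Ring.*-cong (≈-refl {X}) (Ring.+-cong (≈-refl {K 1ℤ})
      (≈-trans (anti-cong double) (anti-+ powers powers))))
    e-eq : surplusGF ≈ X * (K 0ℤ + anti (gf ∘ surplus ∘ suc))
    e-eq = ≈-trans (anti-unfold _) (Ring.*-cong (≈-refl {X})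
      (Ring.+-cong (pointwise λ n → ≡.sym (K-0-at n)) ≈-refl))
    e′-eq : anti (gf ∘ surplus ∘ suc) ≈ X * anti (gf ∘ surplus ∘ suc) + (surplusGF + anti powers)
    e′-eq = ≈-trans
      (anti-X+ {g = gf ∘ surplus ∘ suc} {h = λ u → gf (surplus u) + powers u} λ u → gf-X+
        (≡.sym (≡.trans (+-at _ (powers u) 0) (cong (λ z → + surplus u 0 ℤ.+ z) (K-at-0 _))))
        (λ n → cong (λ z → + surplus (suc u) n ℤ.+ z)
          (≡.sym (≡.trans (+-at _ (powers u) (suc n))
            (≡.trans (cong (λ z → + surplus u (suc n) ℤ.+ z) (K-at-suc _ n)) (ℤ.+-identityʳ (+ surplus u (suc n))))))))
      (Ring.+-cong ≈-refl (anti-+ (gf ∘ surplus) powers))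

  gapGF : ℕ → Series
  gapGF a = anti (gf ∘ gapPart a ∘ suc)

  gapGF-1 : gapGF 1 ≈ X * gapGF 1 + (gapGF 0 + surplusGF)
  gapGF-1 = ≈-trans
    (anti-X+ {g = gf ∘ gapPart 1 ∘ suc} {h = λ u → gf (gapPart 0 (suc u)) + gf (surplus u)} λ u → gf-X+
      (≡.sym (+-at _ _ 0)) (λ n → cong (λ z → + gapPart 1 (suc u) n ℤ.+ z) (≡.sym (+-at _ _ (suc n)))))
    (Ring.+-cong ≈-refl (anti-+ (gf ∘ gapPart 0 ∘ suc) (gf ∘ surplus)))

  gapGF-suc : ∀ a → gapGF (suc a) ≈ (K 1ℤ + - X) * gapGF (suc (suc a))
  gapGF-suc a = modulo
    (S.solve 3 (λ X f g → f S.:= (S.con 1ℤ S.:+ S.:- X) S.:* g S.:+ S.con (ℤ.- 1ℤ) S.:* (g S.:+ S.:- (X S.:* g S.:+ f)))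
      ≈-refl X (gapGF (suc a)) (gapGF (suc (suc a))))
    (null-* _ (anti-X+ {g = gf ∘ gapPart (suc (suc a)) ∘ suc} {h = gf ∘ gapPart (suc a) ∘ suc}
      λ u → gf-X+ refl λ _ → refl))

  -- It makes no difference whether the largest letter lies in the lowest gap or alone above it:
  -- `gapPart 0 (suc (suc b))` and `gapPart 1 (suc b)` obey one recurrence. X is the index shift, as
  -- `gapPart 0 1` is zero.
  gapGF-0 : gapGF 0 ≈ X * gapGF 1
  gapGF-0 = ≈-trans unfolded (Ring.*-cong (≈-refl {X}) (X-fixpoint-unique fixed gapGF-1))
    where
    shifted : Series
    shifted = anti (gf ∘ gapPart 0 ∘ suc ∘ suc)
    fixed : shifted ≈ X * shifted + (gapGF 0 + surplusGF)
    fixed = ≈-trans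
      (anti-X+ {g = gf ∘ gapPart 0 ∘ suc ∘ suc} {h = λ u → gf (gapPart 0 (suc u)) + gf (surplus u)} λ u → gf-X+
        (≡.sym (+-at _ _ 0)) (λ n → cong (λ z → + gapPart 0 (suc (suc u)) n ℤ.+ z) (≡.sym (+-at _ _ (suc n)))))
      (Ring.+-cong ≈-refl (anti-+ (gf ∘ gapPart 0 ∘ suc) (gf ∘ surplus)))
    unfolded : gapGF 0 ≈ X * shifted
    unfolded = ≈-trans (anti-unfold _) (Ring.*-cong (≈-refl {X})
      (pointwise λ n → ≡.trans (+-at _ shifted n) (ℤ.+-identityˡ (shifted n))))

  gapGF-surplus : (K 1ℤ + - (K (+ 2) * X)) * gapGF 1 ≈ surplusGF
  gapGF-surplus = modulo
    (S.solve 4 (λ X y z e →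
       let open S in
       (con 1ℤ :+ :- (con (+ 2) :* X)) :* z := e
         :+ (con 1ℤ :* (z :+ :- (X :* z :+ (y :+ e))) :+ con 1ℤ :* (y :+ :- (X :* z))))
       ≈-refl X (gapGF 0) (gapGF 1) surplusGF)
    (null-+ (null-* _ gapGF-1) (null-* _ gapGF-0))

  newGap-gf : ∀ a → gf (newGapPart a) ≈ X * gapGF a
  newGap-gf a = gf-X refl λ n → at (gf-antidiagonal (gapPart a ∘ suc)) n

  -- Ballot numbers, binomial coefficients and the Catalan series

  pascal : ∀ n k → suc n C suc k ≡ n C k ℕ.+ n C suc k
  pascal n k = ≡.sym (nCk+nC[k+1]≡[n+1]C[k+1] n k)

  nC0≡1 : ∀ n → n C 0 ≡ 1
  nC0≡1 n = ≡.trans (nCk≡nC[n∸k] {0} {n} z≤n) (nCn≡1 n)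

  absorption : ∀ n k → suc k ℕ.* (suc n C suc k) ≡ suc n ℕ.* (n C k)
  absorption zero    zero    = refl
  absorption zero    (suc k) rewrite k>n⇒nCk≡0 {1} {suc (suc k)} (s≤s (s≤s z≤n)) | k>n⇒nCk≡0 {0} {suc k} (s≤s z≤n) =
    ℕ.*-zeroʳ k
  absorption (suc n) zero    rewrite nC1≡n (suc (suc n)) | nC0≡1 (suc n) = solve 1 (λ n → (con 2 :+ n) :+ con 0 := (con 2 :+ n) :* con 1) refl n
    where open ℕ-Solver
  absorption (suc n) (suc k) = begin
    suc (suc k) ℕ.* (suc (suc n) C suc (suc k))
      ≡⟨ cong (suc (suc k) ℕ.*_) (pascal (suc n) (suc k)) ⟩
    suc (suc k) ℕ.* (suc n C suc k ℕ.+ suc n C suc (suc k))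
      ≡⟨ solve 3 (λ k a b → (con 2 :+ k) :* (a :+ b) := (con 1 :+ k) :* a :+ a :+ (con 2 :+ k) :* b) refl
           k (suc n C suc k) (suc n C suc (suc k)) ⟩
    suc k ℕ.* (suc n C suc k) ℕ.+ suc n C suc k ℕ.+ suc (suc k) ℕ.* (suc n C suc (suc k))
      ≡⟨ cong₂ (λ a b → a ℕ.+ suc n C suc k ℕ.+ b) (absorption n k) (absorption n (suc k)) ⟩
    suc n ℕ.* (n C k) ℕ.+ suc n C suc k ℕ.+ suc n ℕ.* (n C suc k)
      ≡⟨ solve 4 (λ n a b c → n :* a :+ c :+ n :* b := c :+ n :* (a :+ b)) refl (suc n) (n C k) (n C suc k) (suc n C suc k) ⟩
    suc n C suc k ℕ.+ suc n ℕ.* (n C k ℕ.+ n C suc k)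
      ≡⟨ cong (λ a → suc n C suc k ℕ.+ suc n ℕ.* a) (pascal n k) ⟨
    suc (suc n) ℕ.* (suc n C suc k) ∎
    where open ≡-Reasoning
          open ℕ-Solver

  C-symm : ∀ k l → (k ℕ.+ l) C k ≡ (k ℕ.+ l) C l
  C-symm k l = ≡.trans (nCk≡nC[n∸k] (ℕ.m≤m+n k l)) (cong ((k ℕ.+ l) C_) (ℕ.m+n∸m≡n k l))

  -- The reflection principle, with the subtraction moved to the left.
  ballot-binomial : ∀ s a m → m ≡ s ℕ.+ s ℕ.+ a → ballot a (suc s) ℕ.+ suc (suc m) C s ≡ suc (suc m) C suc s
  ballot-binomial zero    zero    .0 refl = refl
  ballot-binomial (suc s) zero    m  p = begin
    ballot 1 (suc s) ℕ.+ suc (suc m) C suc s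
      ≡⟨ cong (ballot 1 (suc s) ℕ.+_) (pascal (suc m) s) ⟩
    ballot 1 (suc s) ℕ.+ (suc m C s ℕ.+ suc m C suc s)
      ≡⟨ ℕ.+-assoc (ballot 1 (suc s)) _ _ ⟨
    ballot 1 (suc s) ℕ.+ suc m C s ℕ.+ suc m C suc s
      ≡⟨ cong (ℕ._+ suc m C suc s) (shifted m p) ⟩
    suc m C suc s ℕ.+ suc m C suc s
      -- Here `suc m` is 2 s + 3, an odd number, whose two middle coefficients agree.
      ≡⟨ cong (suc m C suc s ℕ.+_) symm ⟩
    suc m C suc s ℕ.+ suc m C suc (suc s)
      ≡⟨ pascal (suc m) (suc s) ⟨
    suc (suc m) C suc (suc s) ∎
    where
    open ≡-Reasoning
    open ℕ-Solver
    shifted : ∀ m → m ≡ suc s ℕ.+ suc s ℕ.+ 0 → ballot 1 (suc s) ℕ.+ suc m C s ≡ suc m C suc s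
    shifted .(suc (s ℕ.+ suc s ℕ.+ 0)) refl = ballot-binomial s 1 (s ℕ.+ suc s ℕ.+ 0)
      (solve 1 (λ s → s :+ (con 1 :+ s) :+ con 0 := s :+ s :+ con 1) refl s)
    symm : suc m C suc s ≡ suc m C suc (suc s)
    symm = ≡.subst (λ n → n C suc s ≡ n C suc (suc s))
      (≡.trans (solve 1 (λ s → (con 1 :+ s) :+ (con 2 :+ s) := con 1 :+ ((con 1 :+ s) :+ (con 1 :+ s) :+ con 0)) refl s)
        (cong suc (≡.sym p)))
      (C-symm (suc s) (suc (suc s)))
  ballot-binomial s       (suc a) m  p rewrite p | ℕ.+-suc (s ℕ.+ s) a = step s
    where
    open ≡-Reasoning
    open ℕ-Solver
    step : ∀ s → let m = suc (s ℕ.+ s ℕ.+ a) in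
      ballot a (suc s) ℕ.+ ballot (suc (suc a)) s ℕ.+ suc (suc m) C s ≡ suc (suc m) C suc s
    step zero = begin
      ballot a 1 ℕ.+ 1 ℕ.+ suc (suc (suc a)) C 0   ≡⟨ cong (ballot a 1 ℕ.+ 1 ℕ.+_) (nC0≡1 (suc (suc (suc a)))) ⟩
      ballot a 1 ℕ.+ 1 ℕ.+ 1                       ≡⟨ cong (λ z → ballot a 1 ℕ.+ z ℕ.+ 1) (nC0≡1 (suc (suc a))) ⟨
      ballot a 1 ℕ.+ suc (suc a) C 0 ℕ.+ 1         ≡⟨ cong (ℕ._+ 1) (ballot-binomial zero a a refl) ⟩
      suc (suc a) C 1 ℕ.+ 1                        ≡⟨ cong (suc (suc a) C 1 ℕ.+_) (nC0≡1 (suc (suc a))) ⟨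
      suc (suc a) C 1 ℕ.+ suc (suc a) C 0          ≡⟨ ℕ.+-comm (suc (suc a) C 1) _ ⟩
      suc (suc a) C 0 ℕ.+ suc (suc a) C 1          ≡⟨ pascal (suc (suc a)) 0 ⟨
      suc (suc (suc a)) C 1                        ∎
    step (suc s) = begin
      x ℕ.+ y ℕ.+ suc n C suc s          ≡⟨ cong (x ℕ.+ y ℕ.+_) (pascal n s) ⟩
      x ℕ.+ y ℕ.+ (n C s ℕ.+ n C suc s)  ≡⟨ solve 4 (λ x y a b → x :+ y :+ (a :+ b) := y :+ a :+ (x :+ b)) refl x y (n C s) (n C suc s) ⟩
      y ℕ.+ n C s ℕ.+ (x ℕ.+ n C suc s)  ≡⟨ cong₂ ℕ._+_
                                              (ballot-binomial s (suc (suc a)) (suc s ℕ.+ suc s ℕ.+ a)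
                                                (solve 2 (λ s a → (con 1 :+ s) :+ (con 1 :+ s) :+ a := s :+ s :+ (con 2 :+ a)) refl s a))
                                              (ballot-binomial (suc s) a (suc s ℕ.+ suc s ℕ.+ a) refl) ⟩
      n C suc s ℕ.+ n C suc (suc s)      ≡⟨ pascal n (suc s) ⟨
      suc n C suc (suc s)                ∎
      where
      n x y : ℕ
      n = suc (suc (suc s ℕ.+ suc s ℕ.+ a))
      x = ballot a (suc (suc s))
      y = ballot (suc (suc a)) (suc s)

  -- For n = 2 t + 2 reflection gives the ballot number as a difference of neighbouring
  -- coefficients, whose ratio `neighbours` determines; adding a multiple of the central one avoids
  -- subtraction.
  ballot-0-central : ∀ s → ballot 0 s ℕ.* suc s ≡ (2 ℕ.* s) C s
  ballot-0-central zero    = refl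
  ballot-0-central (suc t) = ≡.subst (λ n → ballot 0 (suc t) ℕ.* suc (suc t) ≡ n C suc t)
      (solve 1 (λ t → con 2 :+ (t :+ t) := (con 1 :+ t) :+ (con 1 :+ t :+ con 0)) refl t)
      (ℕ.+-cancelʳ-≡ (suc t ℕ.* (n C suc t)) _ _ (begin
        b ℕ.* suc (suc t) ℕ.+ suc t ℕ.* (n C suc t)
          ≡⟨ cong (b ℕ.* suc (suc t) ℕ.+_) neighbours ⟩
        b ℕ.* suc (suc t) ℕ.+ suc (suc t) ℕ.* (n C t)
          ≡⟨ solve 3 (λ b u c → b :* u :+ u :* c := u :* (b :+ c)) refl b (suc (suc t)) (n C t) ⟩
        suc (suc t) ℕ.* (b ℕ.+ n C t)
          ≡⟨ cong (suc (suc t) ℕ.*_) (ballot-binomial t 0 (t ℕ.+ t) (≡.sym (ℕ.+-identityʳ _))) ⟩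
        suc (suc t) ℕ.* (n C suc t) ∎))
    where
    open ≡-Reasoning
    open ℕ-Solver
    n b : ℕ
    n = suc (suc (t ℕ.+ t))
    b = ballot 0 (suc t)
    neighbours : suc t ℕ.* (n C suc t) ≡ suc (suc t) ℕ.* (n C t)
    neighbours = begin
      suc t ℕ.* (n C suc t)                ≡⟨ absorption (suc (t ℕ.+ t)) t ⟩
      n ℕ.* (suc (t ℕ.+ t) C t)            ≡⟨ cong (λ m → n ℕ.* (m C t)) (ℕ.+-suc t t) ⟨
      n ℕ.* ((t ℕ.+ suc t) C t)            ≡⟨ cong (n ℕ.*_) (C-symm t (suc t)) ⟩
      n ℕ.* ((t ℕ.+ suc t) C suc t)        ≡⟨ cong (λ m → n ℕ.* (m C suc t)) (ℕ.+-suc t t) ⟩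
      n ℕ.* (suc (t ℕ.+ t) C suc t)        ≡⟨ absorption (suc (t ℕ.+ t)) (suc t) ⟨
      suc (suc t) ℕ.* (n C suc (suc t))    ≡⟨ cong (suc (suc t) ℕ.*_) outer ⟨
      suc (suc t) ℕ.* (n C t)              ∎
      where
      outer : n C t ≡ n C suc (suc t)
      outer = ≡.subst (λ m → m C t ≡ m C suc (suc t))
        (≡.trans (ℕ.+-suc t (suc t)) (cong suc (ℕ.+-suc t t))) (C-symm t (suc (suc t)))

  catalan-ballot : ∀ s → catalan s ≡ ballot 0 s
  catalan-ballot s = ≡.trans (cong (λ z → z / suc s) (≡.sym (ballot-0-central s))) (m*n/n≡m (ballot 0 s) (suc s))

  ballotGF : ℕ → Series
  ballotGF a = gf (ballot a)

  ballotGF-0 : ballotGF 0 ≈ X * ballotGF 1 + K 1ℤ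
  ballotGF-0 = gf-X+ (≡.sym (K-at-0 1ℤ))
    λ n → ≡.trans (≡.sym (ℤ.+-identityʳ _)) (cong (λ z → + ballot 1 n ℤ.+ z) (≡.sym (K-at-suc 1ℤ n)))

  ballotGF-suc : ∀ a → ballotGF (suc a) ≈ X * ballotGF (suc (suc a)) + ballotGF a
  ballotGF-suc a = gf-X+ refl λ n → ℤ.+-comm (+ ballot a (suc n)) (+ ballot (suc (suc a)) n)

  -- Both sides obey the ballot recurrence, so their difference falls to `homogeneous-zero`. Hence
  -- `ballotGF a` is C^(a + 1), and the case a = 0 yields the quadratic equation of C.
  ballotGF-* : ∀ a → ballotGF (suc a) ≈ ballotGF 0 * ballotGF a
  ballotGF-* a = modulo
    (S.solve 2 (λ x y → x S.:= y S.:+ S.:- (y S.:+ S.:- x)) ≈-refl (ballotGF (suc a)) (ballotGF 0 * ballotGF a))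
    (≈-trans (Ring.-‿cong (homogeneous-zero P P-0 P-suc a)) (S.solve 0 (S.:- S.con 0ℤ S.:= S.con 0ℤ) ≈-refl))
    where
    P : ℕ → Series
    P a = ballotGF 0 * ballotGF a + - ballotGF (suc a)
    P-0 : P 0 ≈ X * P 1
    P-0 = modulo
      (S.solve 4 (λ X b₀ b₁ b₂ → let open S in
         b₀ :* b₀ :+ :- b₁ := X :* (b₀ :* b₁ :+ :- b₂)
           :+ (b₀ :* (b₀ :+ :- (X :* b₁ :+ con 1ℤ)) :+ con (ℤ.- 1ℤ) :* (b₁ :+ :- (X :* b₂ :+ b₀))))
         ≈-refl X (ballotGF 0) (ballotGF 1) (ballotGF 2))
      (null-+ (null-* _ ballotGF-0) (null-* _ (ballotGF-suc 0)))
    P-suc : ∀ a → P (suc a) ≈ X * P (suc (suc a)) + P a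
    P-suc a = modulo
      (S.solve 6 (λ X b₀ c₀ c₁ c₂ c₃ → let open S in
         b₀ :* c₁ :+ :- c₂ := X :* (b₀ :* c₂ :+ :- c₃) :+ (b₀ :* c₀ :+ :- c₁)
           :+ (b₀ :* (c₁ :+ :- (X :* c₂ :+ c₀)) :+ con (ℤ.- 1ℤ) :* (c₂ :+ :- (X :* c₃ :+ c₁))))
         ≈-refl X (ballotGF 0) (ballotGF a) (ballotGF (suc a)) (ballotGF (suc (suc a))) (ballotGF (suc (suc (suc a)))))
      (null-+ (null-* _ (ballotGF-suc a)) (null-* _ (ballotGF-suc (suc a))))

  Cser-ballot : Cser ≈ ballotGF 0
  Cser-ballot = pointwise λ n → cong +_ (catalan-ballot n)

  ballotGF-quadratic : ballotGF 0 ≈ K 1ℤ + X * (ballotGF 0 * ballotGF 0)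
  ballotGF-quadratic = modulo
    (S.solve 3 (λ X b₀ b₁ → let open S in
       b₀ := con 1ℤ :+ X :* (b₀ :* b₀)
         :+ (con 1ℤ :* (b₀ :+ :- (X :* b₁ :+ con 1ℤ)) :+ X :* (b₁ :+ :- (b₀ :* b₀)))) ≈-refl X (ballotGF 0) (ballotGF 1))
    (null-+ (null-* _ ballotGF-0) (null-* _ (ballotGF-* 0)))

  -- The closed form for every number of letters above the minimum

  freeGF sumGF : ℕ → Series
  freeGF a = gf (freePart a)
  sumGF  a = gf (freePartSum a)

  sumGF-eq : ∀ a → sumGF a ≈ X * (freeGF a + sumGF (suc a))
  sumGF-eq a = gf-X refl λ n → ≡.sym (+-at (freeGF a) _ n)

  freeGF-0 : freeGF 0 ≈ K 1ℤ + (sumGF 0 + X * gapGF 0)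
  freeGF-0 = ≈-trans step (Ring.+-cong ≈-refl (Ring.+-cong ≈-refl (newGap-gf 0)))
    where
    step : freeGF 0 ≈ K 1ℤ + (sumGF 0 + gf (newGapPart 0))
    step = pointwise λ
      { zero    → ≡.sym (≡.trans (+-at _ _ 0) (cong₂ ℤ._+_ (K-at-0 1ℤ) (+-at _ _ 0)))
      ; (suc n) → ≡.sym (≡.trans (+-at _ _ (suc n)) (≡.trans (cong₂ ℤ._+_ (K-at-suc 1ℤ n) (+-at _ _ (suc n))) (ℤ.+-identityˡ _))) }

  freeGF-1 : freeGF 1 ≈ sumGF 1 + (freeGF 0 + X * gapGF 1)
  freeGF-1 = ≈-trans step (Ring.+-cong ≈-refl (Ring.+-cong ≈-refl (newGap-gf 1)))
    where
    step : freeGF 1 ≈ sumGF 1 + (freeGF 0 + gf (newGapPart 1))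
    step = pointwise λ n → ≡.sym (≡.trans (+-at _ _ n) (cong (λ z → + freePartSum 1 n ℤ.+ z) (+-at _ _ n)))

  freeGF-suc : ∀ a → freeGF (suc (suc a)) ≈
    sumGF (suc (suc a)) + (freeGF (suc a) + (ballotGF a + X * gapGF (suc (suc a))))
  freeGF-suc a = ≈-trans step
    (Ring.+-cong ≈-refl (Ring.+-cong ≈-refl (Ring.+-cong ≈-refl (newGap-gf (suc (suc a))))))
    where
    step : freeGF (suc (suc a)) ≈
      sumGF (suc (suc a)) + (freeGF (suc a) + (ballotGF a + gf (newGapPart (suc (suc a)))))
    step = pointwise λ n → ≡.sym (≡.trans (+-at _ _ n) (cong (λ z → + freePartSum (suc (suc a)) n ℤ.+ z)
      (≡.trans (+-at _ _ n) (cong (λ z → + freePart (suc a) n ℤ.+ z) (+-at _ _ n)))))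

  power : ℕ → Series
  power zero    = K 1ℤ
  power (suc a) = ballotGF 0 * power a

  ballotGF-power : ∀ a → ballotGF a ≈ ballotGF 0 * power a
  ballotGF-power zero    = S.solve 1 (λ c → c S.:= c S.:* S.con 1ℤ) ≈-refl (ballotGF 0)
  ballotGF-power (suc a) = ≈-trans (ballotGF-* a) (Ring.*-cong ≈-refl (ballotGF-power a))

  -- The constant series a. It enters because the ballot terms are powers of C, which themselves
  -- solve the homogeneous recurrence; this resonance also produces the factor C (1 - 2 X C), which
  -- equals 2 - C.
  index : ℕ → Series
  index zero    = K 0ℤ
  index (suc a) = K 1ℤ + index a

  -- With C the Catalan series and e the surplus series, X C (1 - 2 X C) freeGF (a + 1) is
  -- C (1 - 2 X C) (1 - 2 X) (e C^(a + 2) - gapGF (a + 1)) + X C^a (a + C).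
  defect : ℕ → Series
  defect zero    =
    let C = ballotGF 0; B = C * (K 1ℤ + - (K (+ 2) * (X * C))) in
    X * (B * freeGF 0) + - (B * ((K 1ℤ + - (K (+ 2) * X)) * (surplusGF * C + - ((K 1ℤ + - X) * gapGF 1)))
      + X * (C * (K 1ℤ + - (K (+ 2) * (X * C)) + X)))
  defect (suc a) =
    let C = ballotGF 0; B = C * (K 1ℤ + - (K (+ 2) * (X * C))) in
    X * (B * freeGF (suc a)) + - (B * ((K 1ℤ + - (K (+ 2) * X)) * (surplusGF * (C * (C * power a)) + - gapGF (suc a)))
      + X * (power a * (index a + C)))

  -- The equations for `freeGF` begin irregularly: a constant 1 enters at 0, and there is no ballot
  -- term at 0 or 1. The formula at 0 is fitted to this and is not the general one continued.
  defect-0 : defect 0 ≈ X * defect 1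
  defect-0 = modulo
    (S.solve 9 (λ X C e v₀ v₁ t₀ t₁ z₀ z₁ →
       let open S
           one = con 1ℤ
           B = C :* (one :+ :- (con (+ 2) :* (X :* C)))
           N = B :* (one :+ :- (con (+ 2) :* X)) in
       X :* (B :* v₀) :+ :- (B :* ((one :+ :- (con (+ 2) :* X)) :* (e :* C :+ :- ((one :+ :- X) :* z₁)))
         :+ X :* (C :* (one :+ :- (con (+ 2) :* (X :* C)) :+ X)))
       := X :* (X :* (B :* v₁) :+ :- (B :* ((one :+ :- (con (+ 2) :* X)) :* (e :* (C :* (C :* one)) :+ :- z₁))
         :+ X :* (one :* (con 0ℤ :+ C))))
       :+ (:- (N :* e) :* (C :+ :- (one :+ X :* (C :* C)))
       :+ (N :* ((one :+ :- (con (+ 2) :* X)) :* z₁ :+ :- e)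
       :+ (X :* B :* (v₀ :+ :- (one :+ (t₀ :+ X :* z₀)))
       :+ (X :* B :* (t₀ :+ :- (X :* (v₀ :+ t₁)))
       :+ (:- (X :* X :* B) :* (v₁ :+ :- (t₁ :+ (v₀ :+ X :* z₁)))
       :+ X :* X :* B :* (z₀ :+ :- (X :* z₁))))))))
       ≈-refl X (ballotGF 0) surplusGF (freeGF 0) (freeGF 1) (sumGF 0) (sumGF 1) (gapGF 0) (gapGF 1))
    (null-+ (null-* _ ballotGF-quadratic) (null-+ (null-* _ gapGF-surplus) (null-+ (null-* _ freeGF-0)
      (null-+ (null-* _ (sumGF-eq 0)) (null-+ (null-* _ freeGF-1) (null-* _ gapGF-0))))))

  defect-1 : defect 1 ≈ X * defect 2 + defect 0
  defect-1 = modulo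
    (S.solve 10 (λ X C e v₀ v₁ v₂ t₁ t₂ z₁ z₂ →
       let open S
           one = con 1ℤ
           B = C :* (one :+ :- (con (+ 2) :* (X :* C)))
           N = B :* (one :+ :- (con (+ 2) :* X)) in
       X :* (B :* v₁) :+ :- (B :* ((one :+ :- (con (+ 2) :* X)) :* (e :* (C :* (C :* one)) :+ :- z₁))
         :+ X :* (one :* (con 0ℤ :+ C)))
       := X :* (X :* (B :* v₂) :+ :- (B :* ((one :+ :- (con (+ 2) :* X)) :* (e :* (C :* (C :* (C :* one))) :+ :- z₂))
         :+ X :* (C :* one :* (one :+ con 0ℤ :+ C))))
       :+ (X :* (B :* v₀) :+ :- (B :* ((one :+ :- (con (+ 2) :* X)) :* (e :* C :+ :- ((one :+ :- X) :* z₁)))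
         :+ X :* (C :* (one :+ :- (con (+ 2) :* (X :* C)) :+ X))))
       :+ (:- (N :* e :* C :+ con (+ 2) :* X :* X :* C) :* (C :+ :- (one :+ X :* (C :* C)))
       :+ (X :* B :* (v₁ :+ :- (t₁ :+ (v₀ :+ X :* z₁)))
       :+ (X :* B :* (t₁ :+ :- (X :* (v₁ :+ t₂)))
       :+ (:- (X :* X :* B) :* (v₂ :+ :- (t₂ :+ (v₁ :+ (C :+ X :* z₂))))
       :+ B :* X :* (one :+ :- X) :* (z₁ :+ :- ((one :+ :- X) :* z₂)))))))
       ≈-refl X (ballotGF 0) surplusGF (freeGF 0) (freeGF 1) (freeGF 2) (sumGF 1) (sumGF 2) (gapGF 1) (gapGF 2))
    (null-+ (null-* _ ballotGF-quadratic) (null-+ (null-* _ freeGF-1) (null-+ (null-* _ (sumGF-eq 1))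
      (null-+ (null-* _ (freeGF-suc 0)) (null-* _ (gapGF-suc 0))))))

  -- Eliminating `sumGF` between two consecutive instances of `freeGF-suc` leaves a three-term
  -- recurrence. Its ballot and gap terms cancel against the closed form by the quadratic equation
  -- and `gapGF-suc`.
  defect-suc : ∀ a → defect (suc a) ≈ X * defect (suc (suc a)) + defect a
  defect-suc zero    = defect-1
  defect-suc (suc a) = modulo
    (S.solve 15 (λ X C e P α v₁ v₂ v₃ t₂ t₃ z₁ z₂ z₃ A₀ A₁ →
       let open S
           one = con 1ℤ
           B = C :* (one :+ :- (con (+ 2) :* (X :* C)))
           N = B :* (one :+ :- (con (+ 2) :* X)) in
       X :* (B :* v₂) :+ :- (B :* ((one :+ :- (con (+ 2) :* X)) :* (e :* (C :* (C :* (C :* P))) :+ :- z₂))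
         :+ X :* (C :* P :* (one :+ α :+ C)))
       := X :* (X :* (B :* v₃) :+ :- (B :* ((one :+ :- (con (+ 2) :* X)) :* (e :* (C :* (C :* (C :* (C :* P)))) :+ :- z₃))
         :+ X :* (C :* (C :* P) :* (one :+ (one :+ α) :+ C))))
       :+ (X :* (B :* v₁) :+ :- (B :* ((one :+ :- (con (+ 2) :* X)) :* (e :* (C :* (C :* P)) :+ :- z₁))
         :+ X :* (P :* (α :+ C))))
       :+ (:- (P :* (N :* e :* C :* C :+ X :* (α :+ C) :+ :- (X :* B))) :* (C :+ :- (one :+ X :* (C :* C)))
       :+ (X :* B :* (v₂ :+ :- (t₂ :+ (v₁ :+ (A₀ :+ X :* z₂))))
       :+ (X :* B :* (t₂ :+ :- (X :* (v₂ :+ t₃)))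
       :+ (:- (X :* X :* B) :* (v₃ :+ :- (t₃ :+ (v₂ :+ (A₁ :+ X :* z₃))))
       :+ (:- N :* (z₁ :+ :- ((one :+ :- X) :* z₂))
       :+ (B :* X :* (one :+ :- X) :* (z₂ :+ :- ((one :+ :- X) :* z₃))
       :+ (X :* B :* (A₀ :+ :- (C :* P))
       :+ :- (X :* X :* B) :* (A₁ :+ :- (C :* (C :* P)))))))))))
       ≈-refl X (ballotGF 0) surplusGF (power a) (index a)
         (freeGF (suc a)) (freeGF (suc (suc a))) (freeGF (suc (suc (suc a))))
         (sumGF (suc (suc a))) (sumGF (suc (suc (suc a))))
         (gapGF (suc a)) (gapGF (suc (suc a))) (gapGF (suc (suc (suc a)))) (ballotGF a) (ballotGF (suc a)))
    (null-+ (null-* _ ballotGF-quadratic) (null-+ (null-* _ (freeGF-suc a)) (null-+ (null-* _ (sumGF-eq _))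
      (null-+ (null-* _ (freeGF-suc (suc a))) (null-+ (null-* _ (gapGF-suc a)) (null-+ (null-* _ (gapGF-suc (suc a)))
      (null-+ (null-* _ (ballotGF-power a)) (null-* _ (ballotGF-power (suc a))))))))))

  -- The numerator and denominator of the theorem

  X-cancel : ∀ {f g} → X * f ≈ X * g → f ≈ g
  X-cancel {f} {g} p = pointwise λ n → ≡.trans (≡.sym (X-*-suc f n)) (≡.trans (at p (suc n)) (X-*-suc g n))

  poly-cong : ∀ a {as f} → poly as ≈ f → poly (a ∷ as) ≈ K a + X * f
  poly-cong a p = ≈-trans (poly-∷ a _) (Ring.+-cong ≈-refl (Ring.*-cong ≈-refl p))

  denom-ring : denom ≈ (K (+ 1) + X * (K (neg 4) + X * (K (+ 4) + X * K 0ℤ)))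
    * ((K (+ 1) + X * (K (neg 4) + X * (K (+ 2) + X * K 0ℤ)))
      + - ((K (+ 0) + X * (K (+ 1) + X * (K (neg 3) + X * K 0ℤ))) * ballotGF 0))
  denom-ring = ≈-trans (⊗≈* _ _) (Ring.*-cong
    (poly-cong _ (poly-cong _ (poly-cong _ poly-[])))
    (≈-trans (⊖≈+- _ _) (Ring.+-cong (poly-cong _ (poly-cong _ (poly-cong _ poly-[])))
      (Ring.-‿cong (≈-trans (⊗≈* _ _) (Ring.*-cong (poly-cong _ (poly-cong _ (poly-cong _ poly-[]))) Cser-ballot))))))

  numer-ring : numer ≈
    (K (+ 0) + X * (K (neg 1) + X * (K (+ 6) + X * (K (neg 11) + X * (K (+ 3) + X * (K (+ 4) + X * K 0ℤ)))))) * ballotGF 0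
    + (K (+ 1) + X * (K (neg 7) + X * (K (+ 16) + X * (K (neg 12) + X * (K (+ 2) + X * K 0ℤ)))))
  numer-ring = ≈-trans (⊕≈+ _ _) (Ring.+-cong
    (≈-trans (⊗≈* _ _) (Ring.*-cong
      (poly-cong _ (poly-cong _ (poly-cong _ (poly-cong _ (poly-cong _ (poly-cong _ poly-[])))))) Cser-ballot))
    (poly-cong _ (poly-cong _ (poly-cong _ (poly-cong _ (poly-cong _ poly-[]))))))

  -- Below g is 1 / C⁴, a linear polynomial in C modulo C = 1 + X C², and q is the quotient for g C (1 - 2 X C).
  freeGF-denom : freeGF 0 ⊗ denom ≈ numer
  -- The closed form determines X times `freeGF 0`, so the identity is proved with a factor X that
  -- is cancelled.
  freeGF-denom = ≈-trans (⊗≈* _ _) (≈-trans (Ring.*-cong ≈-refl denom-ring) (≈-trans (X-cancel (modulo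
    (S.solve 5 (λ X C e v z →
       let open S
           one = con 1ℤ
           q₁  = one :+ :- (con (+ 2) :* X)
           B   = C :* (one :+ :- (con (+ 2) :* (X :* C)))
           s   = X :* q₁
           g   = one :+ :- (con (+ 3) :* X) :+ X :* X :+ :- (s :* C)
           q   = :- (con (+ 2) :* s :* C) :+ (one :+ :- (con (+ 4) :* X) :+ con (+ 2) :* X :* X)
           -- By `gapGF-surplus`, `q₁` times the bracket e C - (1 - X) z of `defect zero` is e m.
           m   = q₁ :* C :+ :- (one :+ :- X) in
       X :* (v :* ((con (+ 1) :+ X :* (con (neg 4) :+ X :* (con (+ 4) :+ X :* con 0ℤ)))
           :* ((con (+ 1) :+ X :* (con (neg 4) :+ X :* (con (+ 2) :+ X :* con 0ℤ)))
             :+ :- ((con (+ 0) :+ X :* (con (+ 1) :+ X :* (con (neg 3) :+ X :* con 0ℤ))) :* C))))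
       := X :* ((con (+ 0) :+ X :* (con (neg 1) :+ X :* (con (+ 6) :+ X :* (con (neg 11) :+ X :* (con (+ 3) :+ X :* (con (+ 4) :+ X :* con 0ℤ)))))) :* C
            :+ (con (+ 1) :+ X :* (con (neg 7) :+ X :* (con (+ 16) :+ X :* (con (neg 12) :+ X :* (con (+ 2) :+ X :* con 0ℤ))))))
       :+ (q₁ :* q₁ :* g :* (X :* (B :* v) :+ :- (B :* (q₁ :* (e :* C :+ :- ((one :+ :- X) :* z)))
             :+ X :* (C :* (one :+ :- (con (+ 2) :* (X :* C)) :+ X))) :+ :- con 0ℤ)
       :+ (g :* B :* m :* (q₁ :* (q₁ :* e) :+ :- (X :* X))
       :+ (:- (q₁ :* q₁ :* g :* B :* (one :+ :- X)) :* (q₁ :* z :+ :- e)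
       :+ (q :* X :* (:- (v :* q₁ :* q₁) :+ X :* m :+ q₁ :* q₁) :+ X :* X :* q₁ :* (q₁ :* q₁ :+ one :+ :- (con (+ 3) :* X)))
          :* (C :+ :- (one :+ X :* (C :* C)))))))
       ≈-refl X (ballotGF 0) surplusGF (freeGF 0) (gapGF 1))
    (null-+ (null-* _ (homogeneous-zero defect defect-0 defect-suc 0)) (null-+ (null-* _ surplus-eq)
      (null-+ (null-* _ gapGF-surplus) (null-* _ ballotGF-quadratic)))))) (≈-sym numer-ring)))

theorem3p40 : ∀ (n : ℕ) → (FT ⊗ denom) n ≡ numer n
theorem3p40 n = ≡.trans (at (⊗-congˡ denom FT-freePart) n) (at freeGF-denom n)
  where
  open Generating
  open SeriesRing using (at; pointwise; _≈_; ⊗-congˡ)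
  FT-freePart : FT ≈ freeGF 0
  FT-freePart = pointwise λ n → cong ℤ.+_ (Counting.countAvoiders-freePart n)
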